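{- Assume that there is a proper class of strongly compact cardinals. Let $(\mathcal{K},U)$ be an accessible category with concrete directed colimits such that $\mathcal{K}$ has the amalgamation property and the joint embedding property. Then $(\mathcal{K},U)$ is tame, i.e. there is a regular cardinal $\kappa$ such that $(\mathcal{K},U)$ is $\kappa$-tame.
   Context: For a regular cardinal $\lambda$, an object $X$ of a category $\mathcal{K}$ is $\lambda$-presentable if $\mathcal{K}(X,-):\mathcal{K}\to\mathbf{Set}$ preserves $\lambda$-directed colimits. $\mathcal{K}$ is $\lambda$-accessible if it has $\lambda$-directed colimits and there is, up to isomorphism, a set $\mathcal{A}$ of $\lambda$-presentable objects such that each object is a $\lambda$-directed colimit of objects of $\mathcal{A}$; it is accessible if it is $\lambda$-accessible for some regular $\lambda$. An accessible category with concrete directed colimits is a pair $(\mathcal{K},U)$ where $\mathcal{K}$ is an accessible category having all directed colimits and $U:\mathcal{K}\to\mathbf{Set}$ is a faithful functor preserving directed colimits. Amalgamation property: every pair of morphisms $f:K\to L$, $g:K\to M$ can be completed to a commutative square by morphisms $L\to N$, $M\to N$. Joint embedding property: for any two objects $K,L$ there is an object $N$ with morphisms $K\to N$ and $L\to N$. A type (over $M$) is a pair $(f,a)$ where $f:M\to N$ is a morphism of $\mathcal{K}$ and $a\in UN$. Types $(f_0,a_0)$ and $(f_1,a_1)$ over the same object $M$, with $f_i:M\to N_i$, are equivalent if there are morphisms $h_0:N_0\to N$ and $h_1:N_1\to N$ with $h_0f_0=h_1f_1$ and $U(h_0)(a_0)=U(h_1)(a_1)$. (Under the amalgamation property this is an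 equivalence relation.) For a regular cardinal $\kappa$, $(\mathcal{K},U)$ is $\kappa$-tame if for any two non-equivalent types $(f,a)$ and $(g,b)$ over the same object $M$ there is a morphism $h:X\to M$ with $X$ $\kappa$-presentable such that the types $(fh,a)$ and $(gh,b)$ are not equivalent. A cardinal $\kappa$ is strongly compact if, for any set $S$, every $\kappa$-complete filter over $S$ can be extended to a $\kappa$-complete ultrafilter over $S$. -}

module Defs where

open import Level using (Level; _⊔_; suc)
open import Data.Nat.Base using (ℕ)
open import Data.Product using (Σ; Σ-syntax; ∃-syntax; _×_)
open import Data.Sum.Base using (_⊎_)
open import Data.Unit.Polymorphic.Base using (⊤)
open import Function.Bundles using (Func; Surjection; _⟨$⟩_; _↣_)
import Function.Construct.Composition as Compose
import Function.Construct.Identity as Identity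
import Function.Relation.Binary.Setoid.Equality as FuncEq
open import Relation.Binary.Bundles using (Setoid; Poset)
open import Relation.Binary.Structures using (IsEquivalence)
open import Relation.Nullary.Negation.Core using (¬_)
open import Relation.Unary using (Pred; _∈_; _∉_; _⊆_; _∩_; ∁; ⋂)
open import Relation.Unary.Polymorphic using (∅; U)

-- Conventions.  "Small" means living in a fixed universe Set ℓ.  The category
-- of sets is the category of small setoids; a category has hom-setoids in that
-- universe and a collection of objects in an arbitrary one.  A cardinal is
-- represented by any small type of that cardinality; bare types lose nothing
-- here, since under choice every small setoid is isomorphic to a small type
-- with propositional equality.

AxiomOfChoice : (ℓ : Level) → Set (suc ℓ)
AxiomOfChoice ℓ = {A B : Setoid ℓ ℓ} (f : Surjection A B) →
  Σ[ g ∈ Func B A ] ((y : Setoid.Carrier B) →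
    Setoid._≈_ B (Surjection.to f (g ⟨$⟩ y)) y)

infix 4 _≺_

_≺_ : {ℓ : Level} → Set ℓ → Set ℓ → Set ℓ
A ≺ B = (A ↣ B) × ¬ (B ↣ A)

-- Infinite, and not reached by a sum of fewer than κ cardinals below κ.
record IsRegular {ℓ : Level} (κ : Set ℓ) : Set (suc ℓ) where
  field
    infinite : ℕ ↣ κ
    Σ-closed : {J : Set ℓ} → J ≺ κ → (B : J → Set ℓ) → (∀ j → B j ≺ κ) → Σ J B ≺ κ

record Filter {ℓ : Level} (S : Set ℓ) : Set (suc ℓ) where
  field
    Member   : Pred (Pred S ℓ) ℓ
    full     : U ∈ Member
    proper   : ∅ ∉ Member
    upward   : {X Y : Pred S ℓ} → X ⊆ Y → X ∈ Member → Y ∈ Member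
    ∩-closed : {X Y : Pred S ℓ} → X ∈ Member → Y ∈ Member → X ∩ Y ∈ Member

open Filter public using (Member)

IsUltrafilter : {ℓ : Level} {S : Set ℓ} → Filter S → Set (suc ℓ)
IsUltrafilter {ℓ} {S} F = (X : Pred S ℓ) → X ∈ Member F ⊎ ∁ X ∈ Member F

IsComplete : {ℓ : Level} {S : Set ℓ} → Set ℓ → Filter S → Set (suc ℓ)
IsComplete {ℓ} {S} κ F = {J : Set ℓ} → J ≺ κ → (X : J → Pred S ℓ) →
  (∀ j → X j ∈ Member F) → ⋂ J X ∈ Member F

IsStronglyCompact : {ℓ : Level} → Set ℓ → Set (suc ℓ)
IsStronglyCompact {ℓ} κ = (S : Set ℓ) (F : Filter S) → IsComplete κ F →
  Σ[ G ∈ Filter S ] IsUltrafilter G × IsComplete κ G × Member F ⊆ Member G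

-- A class of cardinals is proper exactly when it is unbounded.
ProperClassOfStronglyCompacts : (ℓ : Level) → Set (suc ℓ)
ProperClassOfStronglyCompacts ℓ =
  (μ : Set ℓ) → Σ[ κ ∈ Set ℓ ] IsStronglyCompact κ × μ ≺ κ

record Category (o ℓ : Level) : Set (suc (o ⊔ ℓ)) where
  infix  4 _≈_
  infixr 9 _∘_
  field
    Obj       : Set o
    Hom       : Obj → Obj → Set ℓ
    _≈_       : {A B : Obj} → Hom A B → Hom A B → Set ℓ
    idn       : {A : Obj} → Hom A A
    _∘_       : {A B C : Obj} → Hom B C → Hom A B → Hom A C
    equiv     : {A B : Obj} → IsEquivalence (_≈_ {A} {B})
    assoc     : {A B C D : Obj} {f : Hom A B} {g : Hom B C} {h : Hom C D} →
                (h ∘ g) ∘ f ≈ h ∘ (g ∘ f)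
    identityˡ : {A B : Obj} {f : Hom A B} → idn ∘ f ≈ f
    identityʳ : {A B : Obj} {f : Hom A B} → f ∘ idn ≈ f
    ∘-cong    : {A B C : Obj} {f f′ : Hom B C} {g g′ : Hom A B} →
                f ≈ f′ → g ≈ g′ → f ∘ g ≈ f′ ∘ g′

  homSetoid : Obj → Obj → Setoid ℓ ℓ
  homSetoid A B = record { isEquivalence = equiv {A} {B} }

  module HomEq {A B : Obj} = IsEquivalence (equiv {A} {B})

  record _≅_ (A B : Obj) : Set ℓ where
    field
      to   : Hom A B
      from : Hom B A
      isoˡ : from ∘ to ≈ idn
      isoʳ : to ∘ from ≈ idn

record Functor {o ℓ o′ ℓ′ : Level} (C : Category o ℓ) (D : Category o′ ℓ′) :
               Set (o ⊔ ℓ ⊔ o′ ⊔ ℓ′) where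
  private
    module C = Category C
    module D = Category D
  field
    F₀      : C.Obj → D.Obj
    F₁      : {A B : C.Obj} → C.Hom A B → D.Hom (F₀ A) (F₀ B)
    F-cong  : {A B : C.Obj} {f g : C.Hom A B} → f C.≈ g → F₁ f D.≈ F₁ g
    F-id    : {A : C.Obj} → F₁ (C.idn {A}) D.≈ D.idn
    F-∘     : {A B E : C.Obj} {f : C.Hom A B} {g : C.Hom B E} →
              F₁ (g C.∘ f) D.≈ F₁ g D.∘ F₁ f

infixr 9 _∘F_

_∘F_ : {o ℓ o′ ℓ′ o″ ℓ″ : Level}
       {C : Category o ℓ} {D : Category o′ ℓ′} {E : Category o″ ℓ″} →
       Functor D E → Functor C D → Functor C E
_∘F_ {E = E} G F = record
  { F₀     = λ A → G.F₀ (F.F₀ A)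
  ; F₁     = λ f → G.F₁ (F.F₁ f)
  ; F-cong = λ p → G.F-cong (F.F-cong p)
  ; F-id   = E.HomEq.trans (G.F-cong F.F-id) G.F-id
  ; F-∘    = E.HomEq.trans (G.F-cong F.F-∘) G.F-∘
  }
  where
  module E = Category E
  module F = Functor F
  module G = Functor G

IsFaithful : {o ℓ o′ ℓ′ : Level} {C : Category o ℓ} {D : Category o′ ℓ′} →
             Functor C D → Set (o ⊔ ℓ ⊔ ℓ′)
IsFaithful {C = C} {D = D} F = {A B : C.Obj} {f g : C.Hom A B} →
  Functor.F₁ F f D.≈ Functor.F₁ F g → f C.≈ g
  where
  module C = Category C
  module D = Category D

Sets : (ℓ : Level) → Category (suc ℓ) ℓ
Sets ℓ = record
  { Obj       = Setoid ℓ ℓ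
  ; Hom       = Func
  ; _≈_       = λ {A} {B} → FuncEq._≈_ A B
  ; idn       = λ {A} → Identity.function A
  ; _∘_       = λ g f → Compose.function f g
  ; equiv     = λ {A} {B} → FuncEq.isEquivalence A B
  ; assoc     = λ {D = D} _ → Setoid.refl D
  ; identityˡ = λ {B = B} _ → Setoid.refl B
  ; identityʳ = λ {B = B} _ → Setoid.refl B
  ; ∘-cong    = λ {C = C} {f = f} {g′ = g′} p q x →
                  Setoid.trans C (Func.cong f (q x)) (p (g′ ⟨$⟩ x))
  }

HomFunctor : {o ℓ : Level} (K : Category o ℓ) → Category.Obj K → Functor K (Sets ℓ)
HomFunctor K X = record
  { F₀     = homSetoid X
  ; F₁     = λ f → record { to = f ∘_ ; cong = ∘-cong HomEq.refl }
  ; F-cong = λ p _ → ∘-cong p HomEq.refl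
  ; F-id   = λ _ → identityˡ
  ; F-∘    = λ _ → assoc
  }
  where open Category K

SmallPoset : (ℓ : Level) → Set (suc ℓ)
SmallPoset ℓ = Poset ℓ ℓ ℓ

thin : {ℓ : Level} → SmallPoset ℓ → Category ℓ ℓ
thin P = record
  { Obj   = P.Carrier
  ; Hom   = P._≤_
  ; _≈_   = λ _ _ → ⊤
  ; idn   = P.refl
  ; _∘_   = λ q p → P.trans p q
  ; equiv = _
  }
  where module P = Poset P

IsDirected : {ℓ : Level} → SmallPoset ℓ → Set ℓ
IsDirected P = P.Carrier × (∀ i j → ∃[ k ] (i P.≤ k × j P.≤ k))
  where module P = Poset P

-- Every subset of cardinality less than κ, presented as the image of a family,
-- has an upper bound.
IsDirectedFor : {ℓ : Level} → Set ℓ → SmallPoset ℓ → Set (suc ℓ)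
IsDirectedFor {ℓ} κ P = {J : Set ℓ} → J ≺ κ → (x : J → P.Carrier) →
  ∃[ u ] (∀ j → x j P.≤ u)
  where module P = Poset P

Diagram : {o ℓ : Level} → SmallPoset ℓ → Category o ℓ → Set (o ⊔ ℓ)
Diagram P K = Functor (thin P) K

module _ {o ℓ o′ ℓ′ : Level} {I : Category o′ ℓ′} {K : Category o ℓ} where
  private
    module I = Category I
  open Category K
  open Functor

  record Cocone (D : Functor I K) : Set (o ⊔ ℓ ⊔ o′ ⊔ ℓ′) where
    field
      apex    : Obj
      leg     : (i : I.Obj) → Hom (F₀ D i) apex
      commute : {i j : I.Obj} (p : I.Hom i j) → leg j ∘ F₁ D p ≈ leg i

  record IsColimit {D : Functor I K} (c : Cocone D) : Set (o ⊔ ℓ ⊔ o′ ⊔ ℓ′) where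
    open Cocone
    field
      universal : (d : Cocone D) → Hom (apex c) (apex d)
      factors   : (d : Cocone D) (i : I.Obj) → universal d ∘ leg c i ≈ leg d i
      unique    : (d : Cocone D) (h : Hom (apex c) (apex d)) →
                  (∀ i → h ∘ leg c i ≈ leg d i) → h ≈ universal d

mapCocone : {o ℓ o₁ ℓ₁ o₂ ℓ₂ : Level}
            {I : Category o₂ ℓ₂} {K : Category o ℓ} {L : Category o₁ ℓ₁}
            {D : Functor I K} (F : Functor K L) → Cocone D → Cocone (F ∘F D)
mapCocone {L = L} F c = record
  { apex    = F₀ apex
  ; leg     = λ i → F₁ (leg i)
  ; commute = λ p → L.HomEq.trans (L.HomEq.sym F-∘) (F-cong (commute p))
  }
  where
  open Functor F
  open Cocone c
  module L = Category L

HasColimits : {o ℓ : Level} → Category o ℓ → SmallPoset ℓ → Set (o ⊔ ℓ)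
HasColimits K P = (D : Diagram P K) → Σ[ c ∈ Cocone D ] IsColimit c

PreservesColimits : {o ℓ o′ : Level} {K : Category o ℓ} {L : Category o′ ℓ} →
                    Functor K L → SmallPoset ℓ → Set (o ⊔ ℓ ⊔ o′)
PreservesColimits {K = K} F P = (D : Diagram P K) (c : Cocone D) →
  IsColimit c → IsColimit (mapCocone F c)

IsPresentable : {o ℓ : Level} → Set ℓ → (K : Category o ℓ) → Category.Obj K → Set (o ⊔ suc ℓ)
IsPresentable {ℓ = ℓ} κ K X =
  (P : SmallPoset ℓ) → IsDirectedFor κ P → PreservesColimits (HomFunctor K X) P

record IsAccessibleFor {o ℓ : Level} (κ : Set ℓ) (K : Category o ℓ) : Set (o ⊔ suc ℓ) where
  open Category K
  field
    colimits    : (P : SmallPoset ℓ) → IsDirectedFor κ P → HasColimits K P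
    Index       : Set ℓ
    generator   : Index → Obj
    presentable : ∀ a → IsPresentable κ K (generator a)
    generates   : (X : Obj) →
      Σ[ P ∈ SmallPoset ℓ ] IsDirectedFor κ P ×
      Σ[ D ∈ Diagram P K ] (∀ i → ∃[ a ] (Functor.F₀ D i ≅ generator a)) ×
      Σ[ c ∈ Cocone D ] IsColimit c × (Cocone.apex c ≅ X)

IsAccessible : {o ℓ : Level} → Category o ℓ → Set (o ⊔ suc ℓ)
IsAccessible {ℓ = ℓ} K = Σ[ κ ∈ Set ℓ ] IsRegular κ × IsAccessibleFor κ K

record IsAccessibleWithConcreteDirectedColimits
         {o ℓ : Level} (K : Category o ℓ) (U : Functor K (Sets ℓ)) : Set (o ⊔ suc ℓ) where
  field
    accessible        : IsAccessible K
    directedColimits  : (P : SmallPoset ℓ) → IsDirected P → HasColimits K P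
    faithful          : IsFaithful U
    preservesDirected : (P : SmallPoset ℓ) → IsDirected P → PreservesColimits U P

AmalgamationProperty : {o ℓ : Level} → Category o ℓ → Set (o ⊔ ℓ)
AmalgamationProperty K = {A L M : Obj} (f : Hom A L) (g : Hom A M) →
  Σ[ N ∈ Obj ] Σ[ h ∈ Hom L N ] Σ[ k ∈ Hom M N ] h ∘ f ≈ k ∘ g
  where open Category K

JointEmbeddingProperty : {o ℓ : Level} → Category o ℓ → Set (o ⊔ ℓ)
JointEmbeddingProperty K = (A L : Obj) → Σ[ N ∈ Obj ] Hom A N × Hom L N
  where open Category K

module _ {o ℓ : Level} (K : Category o ℓ) (U : Functor K (Sets ℓ)) where
  open Category K
  open Functor U

  record TypeOver (M : Obj) : Set (o ⊔ ℓ) where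
    constructor type
    field
      {target} : Obj
      mor      : Hom M target
      elem     : Setoid.Carrier (F₀ target)

  record Equivalent {M : Obj} (s t : TypeOver M) : Set (o ⊔ ℓ) where
    private
      module s = TypeOver s
      module t = TypeOver t
    field
      {N}      : Obj
      h₀       : Hom s.target N
      h₁       : Hom t.target N
      agree    : h₀ ∘ s.mor ≈ h₁ ∘ t.mor
      identify : Setoid._≈_ (F₀ N) (F₁ h₀ ⟨$⟩ s.elem) (F₁ h₁ ⟨$⟩ t.elem)

  restrict : {X M : Obj} → Hom X M → TypeOver M → TypeOver X
  restrict h (type f a) = type (f ∘ h) a

  IsTameFor : Set ℓ → Set (o ⊔ suc ℓ)
  IsTameFor κ = {M : Obj} (s t : TypeOver M) → ¬ Equivalent s t →
    Σ[ X ∈ Obj ] IsPresentable κ K X ×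
    Σ[ h ∈ Hom X M ] ¬ Equivalent (restrict h s) (restrict h t)

  IsTame : Set (o ⊔ suc ℓ)
  IsTame = Σ[ κ ∈ Set ℓ ] IsRegular κ × IsTameFor κ

{-# OPTIONS --safe #-}

-- Let 𝒦 be μ-accessible and let κ be strongly compact, larger than μ, than the number of
-- generators and than the number of morphisms between generators.  Present M as a
-- μ-directed colimit of generators over a poset Q.  Every family z : List κ → Q generates a
-- μ-directed subposet whose size is bounded independently of M, so for a suitable regular
-- κ⁺ its colimit X_z is a κ⁺-presentable object over M.  Suppose that the restrictions of
-- two types to every X_z are equivalent, with amalgams N_z.  The cones of families covering
-- a given one generate a κ-complete filter; extend it to a κ-complete ultrafilter.  Form
-- the product of the posets presenting the N_z, ordered modulo the ultrafilter.  Since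
-- there are fewer than κ generators and morphisms, the presenting diagrams are constant
-- along each point almost everywhere, which gives a μ-directed diagram of generators on the
-- product.  Its colimit N is an ultraproduct of the N_z inside 𝒦: families of morphisms
-- L → N_z induce L → N, and equations between them, and between elements of U N_z, that
-- hold almost everywhere pass to N.  Every generator over M factors through almost every
-- X_z, so N witnesses that the two types are equivalent.

module Submission where

open import Defs
open import Level using (Level; _⊔_; Lift; lift; lower)
open import Axiom.ExcludedMiddle using (ExcludedMiddle)
open import Axiom.UniquenessOfIdentityProofs.WithK using (uip)
open import Data.Bool.Base using (Bool; true; false)
open import Data.Empty using (⊥-elim)
import Data.Empty.Polymorphic as Empty
open import Data.List.Base using (List; []; _∷_)
open import Data.Maybe.Base using (Maybe; just; nothing)
open import Data.Maybe.Properties using (just-injective)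
open import Data.Nat.Base as ℕ using (ℕ)
open import Data.Product using (Σ; Σ-syntax; ∃-syntax; _×_; _,_; proj₁; proj₂)
open import Data.Sum.Base using (_⊎_; inj₁; inj₂)
open import Data.Unit.Polymorphic.Base using (⊤; tt)
open import Function.Base using (_∘′_; _on_; id)
open import Function.Bundles using (Func; Surjection; _⟨$⟩_; _↣_; mk↣; Injection)
open import Induction.WellFounded using (WellFounded; Acc; acc; module FixPoint)
import Relation.Binary.Construct.On as On
open import Relation.Binary.Bundles using (Setoid; Poset)
open import Relation.Binary.PropositionalEquality
  using (_≡_; _≢_; refl; sym; trans; cong; subst; setoid; _≗_; _→-setoid_)
open import Relation.Nullary.Decidable using (Dec; yes; no; does; decidable-stable; dec-true; dec-false)
open import Relation.Nullary.Negation using (¬_; contradiction)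
open import Relation.Unary using (Pred; _∈_; ∁)

private
  variable
    a b c : Level

-- Injections, small cardinals and classical reasoning.

to : {A : Set a} {B : Set b} → A ↣ B → A → B
to = Injection.to

injective : {A : Set a} {B : Set b} (f : A ↣ B) {x y : A} → to f x ≡ to f y → x ≡ y
injective = Injection.injective

↣-trans : {A : Set a} {B : Set b} {C : Set c} → A ↣ B → B ↣ C → A ↣ C
↣-trans f g = mk↣ λ p → injective f (injective g p)

↣-≺-trans : {A B C : Set a} → A ↣ B → B ≺ C → A ≺ C
↣-≺-trans f (g , ¬h) = ↣-trans f g , λ h → ¬h (↣-trans h f)

empty≺ : {κ : Set a} → ℕ ↣ κ → Empty.⊥ {a} ≺ κ
empty≺ inf = mk↣ {to = λ ()} (λ { {()} }) , λ f → Empty.⊥-elim (to f (to inf 0))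

-- Three distinct naturals cannot take two values injectively. With `empty≺`, this extracts ordinary
-- directedness from directedness for an infinite cardinal.
Bool≺ : {κ : Set a} → ℕ ↣ κ → Lift a Bool ≺ κ
Bool≺ {a} {κ} inf =
  mk↣ {to = λ x → to inf (fromBool (lower x))}
    (λ {x} {y} p → cong lift (fromBool-injective (lower x) (lower y) (injective inf p))) ,
  λ f → absurd f (pigeons (value f 0) (value f 1) (value f 2))
  where
  fromBool : Bool → ℕ
  fromBool true  = 0
  fromBool false = 1

  fromBool-injective : ∀ x y → fromBool x ≡ fromBool y → x ≡ y
  fromBool-injective true  true  _ = refl
  fromBool-injective false false _ = refl

  pigeons : (x y z : Bool) → x ≡ y ⊎ (y ≡ z ⊎ x ≡ z)
  pigeons true  true  _     = inj₁ refl
  pigeons false false _     = inj₁ refl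
  pigeons true  false false = inj₂ (inj₁ refl)
  pigeons false true  true  = inj₂ (inj₁ refl)
  pigeons true  false true  = inj₂ (inj₂ refl)
  pigeons false true  false = inj₂ (inj₂ refl)

  value : κ ↣ Lift a Bool → ℕ → Bool
  value f n = lower (to f (to inf n))

  value-injective : ∀ f {m n} → value f m ≡ value f n → m ≡ n
  value-injective f p = injective inf (injective f (cong lift p))

  absurd : ∀ f → ¬ (value f 0 ≡ value f 1 ⊎ (value f 1 ≡ value f 2 ⊎ value f 0 ≡ value f 2))
  absurd f (inj₁ p)        with value-injective f p
  ... | ()
  absurd f (inj₂ (inj₁ p)) with value-injective f p
  ... | ()
  absurd f (inj₂ (inj₂ p)) with value-injective f p
  ... | ()

does-cong : {A : Set a} {B : Set b} (p : Dec A) (q : Dec B) →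
  (A → B) → (B → A) → does p ≡ does q
does-cong p (yes y) f g = dec-true p (g y)
does-cong p (no ¬y) f g = dec-false p (λ x → ¬y (f x))

does-true : {A : Set a} (p : Dec A) → does p ≡ true → A
does-true (yes x) _ = x

module Classical (em : {a : Level} → ExcludedMiddle a) where

  dne : {A : Set a} → ¬ ¬ A → A
  dne = decidable-stable em

  counterexample : {A : Set a} {B : A → Set b} → ¬ (∀ x → B x) → Σ[ x ∈ A ] ¬ B x
  counterexample ¬all = dne λ ¬ex → ¬all λ x → dne λ ¬Bx → ¬ex (x , ¬Bx)

-- Regular successor cardinals

module Successor {ℓ : Level} (em : {a : Level} → ExcludedMiddle a)
                 (ac : AxiomOfChoice ℓ) (V : Set ℓ) where
  open Classical em

  -- Freely closing `V` under pairing builds in embeddings of ℕ and of `Code × Code`, so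
  -- `Code`-indexed sums of sets embedding in `Code` embed again, by pairing alone.
  data Code : Set ℓ where
    tip  : Code
    base : V → Code
    pair : Code → Code → Code

  pair-injectiveˡ : ∀ {u v x y} → pair u v ≡ pair x y → u ≡ x
  pair-injectiveˡ refl = refl

  pair-injectiveʳ : ∀ {u v x y} → pair u v ≡ pair x y → v ≡ y
  pair-injectiveʳ refl = refl

  -- Trees are compared by rank; ranks range over the ordinals below the
  -- successor cardinal of Code.
  data Tree : Set ℓ where
    zero : Tree
    sup  : (Code → Tree) → Tree

  infix 4 _⊴_ _◁_

  _⊴_ _◁_ : Tree → Tree → Set ℓ
  zero  ⊴ y     = ⊤
  sup f ⊴ y     = ∀ z → f z ◁ y
  x     ◁ zero  = Empty.⊥
  x     ◁ sup g = Σ[ w ∈ Code ] x ⊴ g w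

  ⊴-refl : ∀ x → x ⊴ x
  ⊴-refl zero    = tt
  ⊴-refl (sup f) = λ z → z , ⊴-refl (f z)

  ⊴-trans : ∀ x y z → x ⊴ y → y ⊴ z → x ⊴ z
  ◁-⊴-trans : ∀ x y z → x ◁ y → y ⊴ z → x ◁ z
  ⊴-◁-trans : ∀ x y z → x ⊴ y → y ◁ z → x ◁ z
  ⊴-trans zero    y z p q = tt
  ⊴-trans (sup f) y z p q = λ u → ◁-⊴-trans (f u) y z (p u) q
  ◁-⊴-trans x (sup g) z (w , p) q = ⊴-◁-trans x (g w) z p (q w)
  ⊴-◁-trans x y (sup h) p (v , q) = v , ⊴-trans x y (h v) p q

  ⊴-total : ∀ x y → x ⊴ y ⊎ y ◁ x
  ⊴-total zero    y = inj₁ tt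
  ⊴-total (sup f) y with em {P = ∀ z → f z ◁ y}
  ... | yes p = inj₁ p
  ... | no ¬p with counterexample ¬p
  -- Exchanging the arguments turns the failing branch `z` into `y ⊴ f z`, which puts `y` below
  -- `sup f`.
  ...   | z , ¬q with ⊴-total y (f z)
  ...     | inj₁ r = inj₂ (z , r)
  ...     | inj₂ r = contradiction r ¬q

  -- Different trees can have the same rank, so the induction runs on a tree `x` bounding `y`, not
  -- on `y` itself.
  ⊴⇒Acc : ∀ x {y} → y ⊴ x → Acc _◁_ y
  ⊴⇒Acc x {y} y⊴x = acc λ {y′} y′◁y → go x (◁-⊴-trans y′ y x y′◁y y⊴x)
    where
    go : ∀ x {y} → y ◁ x → Acc _◁_ y
    go (sup g) (w , p) = ⊴⇒Acc (g w) p

  ◁-wellFounded : WellFounded _◁_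
  ◁-wellFounded x = ⊴⇒Acc x (⊴-refl x)

  ◁-irrefl : ∀ x → ¬ x ◁ x
  ◁-irrefl x = go (◁-wellFounded x)
    where
    go : ∀ {x} → Acc _◁_ x → ¬ x ◁ x
    go (acc rs) p = go (rs p) p

  rankSetoid : Setoid ℓ ℓ
  rankSetoid = record
    { Carrier = Tree
    ; _≈_     = λ x y → x ⊴ y × y ⊴ x
    ; isEquivalence = record
      { refl  = λ {x} → ⊴-refl x , ⊴-refl x
      ; sym   = λ (p , q) → q , p
      ; trans = λ {x} {y} {z} (p , q) (p′ , q′) → ⊴-trans x y z p p′ , ⊴-trans z y x q′ q
      }
    }

  open Setoid rankSetoid using () renaming (_≈_ to _∼_; refl to ∼-refl; sym to ∼-sym; trans to ∼-trans)

  quotientMap : Surjection (setoid Tree) rankSetoid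
  quotientMap = record
    { to         = id
    ; cong       = λ { refl → ∼-refl }
    ; surjective = λ y → y , λ { refl → ∼-refl }
    }

  rep : Tree → Tree
  rep x = proj₁ (ac quotientMap) ⟨$⟩ x

  rep-∼ : ∀ x → rep x ∼ x
  rep-∼ = proj₂ (ac quotientMap)

  rep-cong : ∀ {x y} → x ∼ y → rep x ≡ rep y
  rep-cong = Func.cong (proj₁ (ac quotientMap))

  -- The fixed points of `rep` contain exactly one tree of each rank. The quotient thus becomes a
  -- bare type with propositional equality, as `↣` requires.
  κ⁺ : Set ℓ
  κ⁺ = Σ[ x ∈ Tree ] rep x ≡ x

  rank : Tree → κ⁺
  rank x = rep x , rep-cong (rep-∼ x)

  infix 4 _<_

  _<_ : κ⁺ → κ⁺ → Set ℓ
  _<_ = _◁_ on proj₁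

  <-wellFounded : WellFounded _<_
  <-wellFounded = On.wellFounded proj₁ ◁-wellFounded

  ∼⇒≡ : {x y : κ⁺} → proj₁ x ∼ proj₁ y → x ≡ y
  ∼⇒≡ {x , p} {y , q} x∼y with trans (sym p) (trans (rep-cong x∼y) q)
  ... | refl = cong (x ,_) (uip p q)

  <-compare : (x y : κ⁺) → x ≡ y ⊎ (x < y ⊎ y < x)
  <-compare (x , p) (y , q) with ⊴-total x y | ⊴-total y x
  ... | inj₂ r | _      = inj₂ (inj₂ r)
  ... | _      | inj₂ r = inj₂ (inj₁ r)
  ... | inj₁ r | inj₁ s = inj₁ (∼⇒≡ (r , s))

  -- Induction on `x`: a rank below `sup f` is below or equal to some `f w`; it is coded by `w`,
  -- followed in the first case by its code below `f w`. The map is total, but injective only below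
  -- `x`.
  segment-code : (x : Tree) → Σ[ e ∈ (κ⁺ → Code) ]
    (∀ {u v} → proj₁ u ◁ x → proj₁ v ◁ x → e u ≡ e v → u ≡ v)
  segment-code zero    = (λ _ → tip) , λ ()
  segment-code (sup f) = e , e-injective
    where
    Stage : κ⁺ → Code → Set ℓ
    Stage u w = proj₁ u ◁ f w ⊎ proj₁ u ∼ f w

    stage : ∀ u → proj₁ u ◁ sup f → Σ Code (Stage u)
    stage u (w , p) with ⊴-total (f w) (proj₁ u)
    ... | inj₁ q = w , inj₂ (p , q)
    ... | inj₂ q = w , inj₁ q

    encode : ∀ u → Dec (Σ Code (Stage u)) → Code
    -- `pair tip _` marks the strict case and `tip` the case of equal rank, so the two never
    -- collide.
    encode u (yes (w , inj₁ _)) = pair w (pair tip (proj₁ (segment-code (f w)) u))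
    encode u (yes (w , inj₂ _)) = pair w tip
    encode u (no _)             = tip

    e : κ⁺ → Code
    e u = encode u em

    encode-injective : ∀ {u v} (p : Dec (Σ Code (Stage u))) (q : Dec (Σ Code (Stage v))) →
      proj₁ u ◁ sup f → proj₁ v ◁ sup f → encode u p ≡ encode v q → u ≡ v
    encode-injective {u} (no ¬p) _ u◁ _ _ = contradiction (stage u u◁) ¬p
    encode-injective {v = v} (yes _) (no ¬q) _ v◁ _ = contradiction (stage v v◁) ¬q
    encode-injective (yes (w , inj₁ p)) (yes (w′ , inj₁ q)) _ _ eq with pair-injectiveˡ eq
    ... | refl = proj₂ (segment-code (f w)) p q (pair-injectiveʳ (pair-injectiveʳ eq))
    encode-injective (yes (w , inj₂ p)) (yes (w′ , inj₂ q)) _ _ eq with pair-injectiveˡ eq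
    ... | refl = ∼⇒≡ (∼-trans p (∼-sym q))
    encode-injective (yes (w , inj₁ p)) (yes (w′ , inj₂ q)) _ _ eq with pair-injectiveʳ eq
    ... | ()
    encode-injective (yes (w , inj₂ p)) (yes (w′ , inj₁ q)) _ _ eq with pair-injectiveʳ eq
    ... | ()

    e-injective : ∀ {u v} → proj₁ u ◁ sup f → proj₁ v ◁ sup f → e u ≡ e v → u ≡ v
    e-injective = encode-injective em em

  -- An injection would make the supremum of all ranks an ordinal of κ⁺ above itself.
  κ⁺↣̸Code : ¬ (κ⁺ ↣ Code)
  κ⁺↣̸Code i = ◁-irrefl top (⊴-◁-trans top (rep top) top (proj₂ (rep-∼ top)) rep-top◁top)
    where
    decode : ∀ z → Dec (∃[ x ] to i x ≡ z) → Tree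
    decode z (yes (x , _)) = proj₁ x
    decode z (no _)        = zero

    decode-to : ∀ x (d : Dec (∃[ y ] to i y ≡ to i x)) → decode (to i x) d ≡ proj₁ x
    decode-to x (yes (y , p)) = cong proj₁ (injective i p)
    decode-to x (no ¬p)       = contradiction (x , refl) ¬p

    top : Tree
    top = sup λ z → decode z em

    rep-top◁top : rep top ◁ top
    rep-top◁top = to i (rank top) ,
      subst (rep top ⊴_) (sym (decode-to (rank top) em)) (⊴-refl (rep top))

  -- Transfinite enumeration of a set along `κ⁺`.

  module _ (B : Set ℓ) where

    Picks : (B → Bool) → Maybe B → Set ℓ
    Picks X m = (∀ b → m ≡ just b → X b ≡ true) × (m ≡ nothing → ∀ b → X b ≡ false)

    pickExists : ∀ X → ∃[ m ] Picks X m
    pickExists X with em {P = ∃[ b ] X b ≡ true}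
    ... | yes (b , p) = just b , (λ { _ refl → p }) , λ ()
    ... | no ¬ex      = nothing , (λ _ ()) , λ _ b → go (X b) λ p → ¬ex (b , p)
      where
      go : ∀ x → x ≢ true → x ≡ false
      go true  x≢true = contradiction refl x≢true
      go false _      = refl

    pickSetoid : Setoid ℓ ℓ
    pickSetoid = record
      { Carrier = Σ[ X ∈ (B → Bool) ] Σ (Maybe B) (Picks X)
      ; _≈_ = λ (X , m , _) (Y , n , _) → X ≗ Y × m ≡ n
      ; isEquivalence = record
        { refl  = (λ _ → refl) , refl
        ; sym   = λ (p , q) → (λ b → sym (p b)) , sym q
        ; trans = λ (p , q) (p′ , q′) → (λ b → trans (p b) (p′ b)) , trans q q′
        }
      }

    forgetPick : Surjection pickSetoid (B →-setoid Bool)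
    forgetPick = record
      { to         = proj₁
      ; cong       = proj₁
      ; surjective = λ X → (X , pickExists X) , proj₁
      }

    -- Choice is needed here, beyond excluded middle, to make the choice of an
    -- element extensional in the subset.
    pick : (B → Bool) → Maybe B
    pick X = proj₁ (proj₂ (proj₁ (ac forgetPick) ⟨$⟩ X))

    pick-cong : ∀ {X Y} → X ≗ Y → pick X ≡ pick Y
    pick-cong X≗Y = proj₂ (Func.cong (proj₁ (ac forgetPick)) X≗Y)

    pick-picks : ∀ X → Picks X (pick X)
    pick-picks X with proj₁ (ac forgetPick) ⟨$⟩ X | proj₂ (ac forgetPick) X
    ... | Y , m , (p , q) | Y≗X =
      (λ b eq → trans (sym (Y≗X b)) (p b eq)) , λ eq b → trans (sym (Y≗X b)) (q eq b)

    Fresh : ∀ x → (∀ {y} → y < x → Maybe B) → B → Set ℓ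
    Fresh x prev b = ∀ {y} (y<x : y < x) → prev {y} y<x ≢ just b

    step : ∀ x → (∀ {y} → y < x → Maybe B) → Maybe B
    step x prev = pick λ b → does (em {P = Fresh x (λ {y} → prev {y}) b})

    -- `FixPoint` needs this to unfold the recursion. Freshness depends only on the values of
    -- `prev`, and `pick-cong` passes from pointwise equal subsets to equal picks.
    step-ext : ∀ x {prev prev′ : ∀ {y} → y < x → Maybe B} →
      (∀ {y} (y<x : y < x) → prev {y} y<x ≡ prev′ {y} y<x) →
      step x (λ {y} → prev {y}) ≡ step x (λ {y} → prev′ {y})
    step-ext x eq = pick-cong λ b → does-cong em em
      (λ fresh {y} y<x p → fresh {y} y<x (trans (eq {y} y<x) p))
      (λ fresh {y} y<x p → fresh {y} y<x (trans (sym (eq {y} y<x)) p))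

    open FixPoint <-wellFounded (λ _ → Maybe B) step step-ext
    open Induction.WellFounded.All <-wellFounded ℓ using (wfRec)

    enumerate : κ⁺ → Maybe B
    enumerate = wfRec (λ _ → Maybe B) step

    enumerate-picks : ∀ x →
      Picks (λ b → does (em {P = Fresh x (λ {y} _ → enumerate y) b})) (enumerate x)
    enumerate-picks x = subst (Picks _) (sym (unfold-wfRec {x})) (pick-picks _)

    enumerate-fresh : ∀ {x y b} → enumerate x ≡ just b → y < x → enumerate y ≢ just b
    enumerate-fresh {x} {y} {b} eq y<x =
      does-true (em {P = Fresh x (λ {y} _ → enumerate y) b})
        (proj₁ (enumerate-picks x) b eq) {y} y<x

    enumerate-exhausted : ∀ {x} → enumerate x ≡ nothing → ∀ b →
      ∃[ y ] (y < x × enumerate y ≡ just b)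
    -- An element not listed before `x` would be fresh at `x`, while `pick` returns `nothing` only
    -- on the empty subset.
    enumerate-exhausted {x} eq b = dne λ ¬ex →
      true≢false (trans (sym (dec-true em λ {y} y<x p → ¬ex (y , y<x , p)))
                        (proj₂ (enumerate-picks x) eq b))
      where
      true≢false : true ≢ false
      true≢false ()

    -- The recursion lists fresh elements of `B` while there are any. If it never stops, it is an
    -- injection from `κ⁺`; if it stops at `x`, every element of `B` has a position below `x`, and
    -- `segment-code` codes these positions.
    compare : (κ⁺ ↣ B) ⊎ (B ↣ Code × B ↣ κ⁺)
    compare with em {P = ∃[ x ] enumerate x ≡ nothing}
    ... | yes (x , eq) =
      let at b = enumerate-exhausted {x} eq b
          at-injective : ∀ {b c} → proj₁ (at b) ≡ proj₁ (at c) → b ≡ c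
          at-injective {b} {c} p = just-injective
            (trans (sym (proj₂ (proj₂ (at b)))) (trans (cong enumerate p) (proj₂ (proj₂ (at c)))))
          (e , e-injective) = segment-code (proj₁ x)
      in inj₂ ( mk↣ {to = λ b → e (proj₁ (at b))}
                  (λ {b} {c} p → at-injective
                    (e-injective (proj₁ (proj₂ (at b))) (proj₁ (proj₂ (at c))) p))
              , mk↣ at-injective)
    ... | no ¬stuck = inj₁ (mk↣ {to = λ x → proj₁ (value x)} value-injective)
      where
      fromJust : ∀ {m : Maybe B} → m ≢ nothing → ∃[ b ] m ≡ just b
      fromJust {just b}  _ = b , refl
      fromJust {nothing} p = contradiction refl p

      value : ∀ x → ∃[ b ] enumerate x ≡ just b
      value x = fromJust λ p → ¬stuck (x , p)

      value-injective : ∀ {x y} → proj₁ (value x) ≡ proj₁ (value y) → x ≡ y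
      value-injective {x} {y} p with <-compare x y
      ... | inj₁ eq = eq
      ... | inj₂ (inj₁ x<y) = ⊥-elim (enumerate-fresh {y} {x} (proj₂ (value y)) x<y
              (trans (proj₂ (value x)) (cong just p)))
      ... | inj₂ (inj₂ y<x) = ⊥-elim (enumerate-fresh {x} {y} (proj₂ (value x)) y<x
              (trans (proj₂ (value y)) (cong just (sym p))))

  -- With the converse below, this identifies `κ⁺` as the successor cardinal of `Code`. Regularity
  -- then reduces to `Σ↣Code`.
  ≺κ⁺⇒↣Code : {B : Set ℓ} → B ≺ κ⁺ → B ↣ Code
  ≺κ⁺⇒↣Code {B} (_ , ¬i) with compare B
  ... | inj₁ i       = contradiction i ¬i
  ... | inj₂ (e , _) = e

  ↣Code⇒≺κ⁺ : {B : Set ℓ} → B ↣ Code → B ≺ κ⁺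
  ↣Code⇒≺κ⁺ {B} e with compare B
  ... | inj₁ i       = contradiction (↣-trans i e) κ⁺↣̸Code
  ... | inj₂ (_ , j) = j , λ i → κ⁺↣̸Code (↣-trans i e)

  Σ↣Code : {J : Set ℓ} {B : J → Set ℓ} → J ↣ Code → (∀ j → B j ↣ Code) → Σ J B ↣ Code
  Σ↣Code {J} {B} e f = mk↣ {to = λ (j , b) → pair (to e j) (to (f j) b)} inj
    where
    inj : ∀ {u v : Σ J B} →
      pair (to e (proj₁ u)) (to (f (proj₁ u)) (proj₂ u)) ≡
      pair (to e (proj₁ v)) (to (f (proj₁ v)) (proj₂ v)) → u ≡ v
    inj {j , b} {j′ , b′} eq with injective e (pair-injectiveˡ eq)
    ... | refl = cong (j ,_) (injective (f j) (pair-injectiveʳ eq))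

  ℕ↣Code : ℕ ↣ Code
  ℕ↣Code = mk↣ {to = numeral} (numeral-injective _ _)
    where
    numeral : ℕ → Code
    numeral ℕ.zero    = tip
    numeral (ℕ.suc n) = pair tip (numeral n)

    numeral-injective : ∀ m n → numeral m ≡ numeral n → m ≡ n
    numeral-injective ℕ.zero    ℕ.zero    _  = refl
    numeral-injective (ℕ.suc m) (ℕ.suc n) eq =
      cong ℕ.suc (numeral-injective m n (pair-injectiveʳ eq))

  Code↣κ⁺ : Code ↣ κ⁺
  Code↣κ⁺ = proj₁ (↣Code⇒≺κ⁺ (mk↣ id))

  κ⁺-regular : IsRegular κ⁺
  κ⁺-regular = record
    { infinite = ↣-trans ℕ↣Code Code↣κ⁺
    ; Σ-closed = λ J≺ B B≺ →
        ↣Code⇒≺κ⁺ (Σ↣Code (≺κ⁺⇒↣Code J≺) λ j → ≺κ⁺⇒↣Code (B≺ j))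
    }

  V↣Code : V ↣ Code
  V↣Code = mk↣ {to = base} λ { refl → refl }

  ≺κ⁺ : {B : Set ℓ} → B ↣ V → B ≺ κ⁺
  ≺κ⁺ i = ↣Code⇒≺κ⁺ (↣-trans i V↣Code)

  ×≺κ⁺ : (V × V) ≺ κ⁺
  ×≺κ⁺ = ↣Code⇒≺κ⁺ (Σ↣Code V↣Code λ _ → V↣Code)

-- Colimits in Sets and presentability

module SetColimit {ℓ : Level} (P : SmallPoset ℓ) (directed : IsDirected P)
                  (D : Diagram P (Sets ℓ)) where
  open Poset P using (_≤_) renaming (Carrier to I; trans to ≤-trans; refl to ≤-refl)
  open Functor D
  private
    module D i = Setoid (F₀ i)

  -- With `Separated`, this is the elementwise description of a directed colimit of sets. For a hom
  -- functor the two become the factorisation and equalisation properties of a presentable object.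
  JointlySurjective : Cocone D → Set ℓ
  JointlySurjective c = ∀ x → Σ[ i ∈ I ] Σ[ d ∈ D.Carrier i ] Setoid._≈_ apex (leg i ⟨$⟩ d) x
    where open Cocone c

  Separated : Cocone D → Set ℓ
  Separated c = ∀ {i} (d e : D.Carrier i) → Setoid._≈_ apex (leg i ⟨$⟩ d) (leg i ⟨$⟩ e) →
    Σ[ k ∈ I ] Σ[ p ∈ i ≤ k ] D._≈_ k (F₁ p ⟨$⟩ d) (F₁ p ⟨$⟩ e)
    where open Cocone c

  F₁-thin : ∀ {i j} (p q : i ≤ j) d → D._≈_ j (F₁ p ⟨$⟩ d) (F₁ q ⟨$⟩ d)
  F₁-thin p q = F-cong {f = p} {g = q} tt

  F₁-through : ∀ {i j k} (p : i ≤ j) (q : j ≤ k) (r : i ≤ k) d →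
    D._≈_ k (F₁ q ⟨$⟩ (F₁ p ⟨$⟩ d)) (F₁ r ⟨$⟩ d)
  F₁-through {k = k} p q r d = D.trans k (D.sym k (F-∘ {f = p} {g = q} d)) (F₁-thin _ r d)

  germs : Setoid ℓ ℓ
  germs = record
    { Carrier = Σ I D.Carrier
    ; _≈_ = λ (i , d) (j , e) →
        Σ[ k ∈ I ] Σ[ p ∈ i ≤ k ] Σ[ q ∈ j ≤ k ] D._≈_ k (F₁ p ⟨$⟩ d) (F₁ q ⟨$⟩ e)
    ; isEquivalence = record
      { refl  = λ {(i , _)} → i , ≤-refl , ≤-refl , D.refl i
      ; sym   = λ (k , p , q , eq) → k , q , p , D.sym k eq
      ; trans = λ {(_ , d)} {(_ , e)} {(_ , f)} (k , p , q , eq) (k′ , p′ , q′ , eq′) →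
          let m , r , r′ = proj₂ directed k k′ in
          m , ≤-trans p r , ≤-trans q′ r′ ,
          D.trans m (F-∘ {f = p} {g = r} d) (D.trans m (Func.cong (F₁ r) eq)
            (D.trans m (F₁-through q r (≤-trans q r) e)
              (D.trans m (D.sym m (F₁-through p′ r′ (≤-trans q r) e))
                (D.trans m (Func.cong (F₁ r′) eq′)
                  (D.sym m (F-∘ {f = q′} {g = r′} f))))))
      }
    }

  germCocone : Cocone D
  germCocone = record
    { apex    = germs
    ; leg     = λ i → record
        { to = i ,_ ; cong = λ eq → i , ≤-refl , ≤-refl , Func.cong (F₁ ≤-refl) eq }
    ; commute = λ {i} {j} p d → j , ≤-refl , p , F-id (F₁ p ⟨$⟩ d)
    }

  module _ {c : Cocone D} where
    open Cocone c
    private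
      module C = Setoid apex

    module _ (colimit : IsColimit c) where
      open IsColimit colimit

      private
        germ : Func apex germs
        germ = universal germCocone

        realise : Func germs apex
        realise = record
          { to   = λ (i , d) → leg i ⟨$⟩ d
          ; cong = λ {(i , d)} {(j , e)} (k , p , q , eq) →
              C.trans (C.sym (commute p d)) (C.trans (Func.cong (leg k) eq) (commute q e))
          }

        -- The composite and the identity are both maps from the cocone `c` to itself, so uniqueness
        -- equates them.
        realise-germ : ∀ x → realise ⟨$⟩ (germ ⟨$⟩ x) C.≈ x
        realise-germ x = C.trans
          (unique c (record { to = λ y → realise ⟨$⟩ (germ ⟨$⟩ y)
                            ; cong = λ eq → Func.cong realise (Func.cong germ eq) })
            (λ i d → Func.cong realise (factors germCocone i d)) x)
          (C.sym (unique c (record { to = id ; cong = id }) (λ i d → C.refl) x))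

      colimit⇒surjective : JointlySurjective c
      colimit⇒surjective x =
        proj₁ (germ ⟨$⟩ x) , proj₂ (germ ⟨$⟩ x) , realise-germ x

      colimit⇒separated : Separated c
      colimit⇒separated {i} d e eq =
        let γ  = germ ⟨$⟩ (leg i ⟨$⟩ d)
            γ′ = germ ⟨$⟩ (leg i ⟨$⟩ e)
            module G = Setoid germs
            k , p , q , eq′ = G.trans {i = i , d} {j = γ} {k = i , e}
              (G.sym {x = γ} {y = i , d} (factors germCocone i d))
              (G.trans {i = γ} {j = γ′} {k = i , e} (Func.cong germ eq) (factors germCocone i e))
        in k , p , D.trans k eq′ (F₁-thin q p e)

    -- The mediating map evaluates at a chosen preimage. `leg-cong` makes the choice harmless: two
    -- preimages move to a common stage, where separation identifies them.
    surjective∧separated⇒colimit : JointlySurjective c → Separated c → IsColimit c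
    surjective∧separated⇒colimit surj sep = record
      { universal = λ d → record { to = value d ; cong = λ {x} {y} → value-cong d x y }
      ; factors   = λ d i e → leg-cong d (proj₂ (proj₂ (surj (leg i ⟨$⟩ e))))
      ; unique    = λ d h eq x → let i , e , p = surj x in
          Setoid.trans (apex′ d) (Setoid.sym (apex′ d) (Func.cong h p)) (eq i e)
      }
      where
      open Cocone using () renaming (apex to apex′; leg to leg′; commute to commute′)

      leg-cong : ∀ d {i j x y} → leg i ⟨$⟩ x C.≈ leg j ⟨$⟩ y →
        Setoid._≈_ (apex′ d) (leg′ d i ⟨$⟩ x) (leg′ d j ⟨$⟩ y)
      leg-cong d {i} {j} {x} {y} eq =
        let k , p , q = proj₂ directed i j
            m , r , eq′ = sep (F₁ p ⟨$⟩ x) (F₁ q ⟨$⟩ y)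
              (C.trans (commute p x) (C.trans eq (C.sym (commute q y))))
            module E = Setoid (apex′ d)
        in E.trans (E.sym (E.trans (commute′ d r (F₁ p ⟨$⟩ x)) (commute′ d p x)))
             (E.trans (Func.cong (leg′ d m) eq′) (E.trans (commute′ d r (F₁ q ⟨$⟩ y)) (commute′ d q y)))

      value : ∀ d → C.Carrier → Setoid.Carrier (apex′ d)
      value d x = leg′ d (proj₁ (surj x)) ⟨$⟩ proj₁ (proj₂ (surj x))

      value-cong : ∀ d x y → x C.≈ y → Setoid._≈_ (apex′ d) (value d x) (value d y)
      value-cong d x y eq = leg-cong d
        (C.trans (proj₂ (proj₂ (surj x))) (C.trans eq (C.sym (proj₂ (proj₂ (surj y))))))

module Composition {o ℓ : Level} (K : Category o ℓ) where
  open Category K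

  ∘-congˡ : ∀ {A B C} {f f′ : Hom B C} {g : Hom A B} → f ≈ f′ → f ∘ g ≈ f′ ∘ g
  ∘-congˡ p = ∘-cong p HomEq.refl

  ∘-congʳ : ∀ {A B C} {f : Hom B C} {g g′ : Hom A B} → g ≈ g′ → f ∘ g ≈ f ∘ g′
  ∘-congʳ p = ∘-cong HomEq.refl p

  pullˡ : ∀ {A B C D} {f : Hom C D} {g : Hom B C} {h : Hom B D} {k : Hom A B} →
    f ∘ g ≈ h → f ∘ g ∘ k ≈ h ∘ k
  pullˡ p = HomEq.trans (HomEq.sym assoc) (∘-congˡ p)

  extendˡ : ∀ {A B C C′ D} {f : Hom C D} {g : Hom B C} {f′ : Hom C′ D} {g′ : Hom B C′}
    {k : Hom A B} → f ∘ g ≈ f′ ∘ g′ → f ∘ g ∘ k ≈ f′ ∘ g′ ∘ k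
  extendˡ p = HomEq.trans (pullˡ p) assoc

  cancelˡ : ∀ {A B C} {f : Hom C B} {g : Hom B C} {k : Hom A B} →
    f ∘ g ≈ idn → f ∘ g ∘ k ≈ k
  cancelˡ p = HomEq.trans (pullˡ p) identityˡ

  module _ (I : SmallPoset ℓ) (D : Diagram I K) where
    open Poset I using (_≤_)
    open Functor D

    F₁-thin : ∀ {i j} (p q : i ≤ j) → F₁ p ≈ F₁ q
    F₁-thin p q = F-cong {f = p} {g = q} tt

    F₁-through : ∀ {i j k} (p : i ≤ j) (q : j ≤ k) (r : i ≤ k) → F₁ q ∘ F₁ p ≈ F₁ r
    F₁-through p q r = HomEq.trans (HomEq.sym (F-∘ {f = p} {g = q})) (F₁-thin _ r)

  jointly-epic : ∀ (I : SmallPoset ℓ) {D : Diagram I K} {c : Cocone D} → IsColimit c →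
    ∀ {X} {f g : Hom (Cocone.apex c) X} →
    (∀ i → f ∘ Cocone.leg c i ≈ g ∘ Cocone.leg c i) → f ≈ g
  jointly-epic I {D} {c} colimit {X} {f} {g} eq =
    HomEq.trans (unique d f eq) (HomEq.sym (unique d g λ _ → HomEq.refl))
    where
    open IsColimit colimit
    d : Cocone D
    d = record
      { apex    = X
      ; leg     = λ i → g ∘ Cocone.leg c i
      ; commute = λ p → HomEq.trans assoc (∘-congʳ (Cocone.commute c p))
      }

  module Presentability {X : Obj} (P : SmallPoset ℓ) (directed : IsDirected P)
    (D : Diagram P K) {c : Cocone D}
    (preserved : IsColimit (mapCocone (HomFunctor K X) c)) where
    open Poset P using (_≤_) renaming (Carrier to I)
    open Functor D
    open Cocone c
    open SetColimit P directed (HomFunctor K X ∘F D)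

    factor : (v : Hom X apex) → Σ[ i ∈ I ] Σ[ w ∈ Hom X (F₀ i) ] leg i ∘ w ≈ v
    factor = colimit⇒surjective preserved

    equalise : ∀ {i} (v w : Hom X (F₀ i)) → leg i ∘ v ≈ leg i ∘ w →
      Σ[ k ∈ I ] Σ[ p ∈ i ≤ k ] F₁ p ∘ v ≈ F₁ p ∘ w
    equalise = colimit⇒separated preserved

  module _ (em : {a : Level} → ExcludedMiddle a) {μ κ : Set ℓ}
    (≺μ⇒≺κ : {J : Set ℓ} → J ≺ μ → J ≺ κ)
    (directedFor⇒directed : (P : SmallPoset ℓ) → IsDirectedFor κ P → IsDirected P)
    {Q : SmallPoset ℓ}
    (Q≺κ : Poset.Carrier Q ≺ κ) (Q²≺κ : (Poset.Carrier Q × Poset.Carrier Q) ≺ κ)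
    (E : Diagram Q K) (presentable : ∀ t → IsPresentable μ K (Functor.F₀ E t))
    {c : Cocone E} (colimit : IsColimit c)
    where
    private
      module Q = Poset Q
      module E = Functor E
    open Cocone c using (apex; leg; commute)
    open IsColimit colimit

    -- Each restriction of a map to some `E.F₀ t` factors through a stage of `D`. Fewer than `κ`
    -- such stages have a common bound, and a second bound over pairs from `Q` makes the
    -- factorisations a cocone, which induces the lift.
    small-colimit-presentable : IsPresentable κ K apex
    small-colimit-presentable P κ-directed D d d-colimit =
      surjective∧separated⇒colimit {c = mapCocone (HomFunctor K apex) d} surj sep
      where
      open Poset P using (_≤_) renaming (Carrier to R; trans to ≤-trans)
      open Functor D
      open Cocone d using () renaming (apex to apex′; leg to leg′; commute to commute′)
      open HomEq renaming (sym to ≈-sym; trans to ≈-trans; refl to ≈-refl)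

      directed : IsDirected P
      directed = directedFor⇒directed P κ-directed

      open SetColimit P directed (HomFunctor K apex ∘F D)
        using (JointlySurjective; Separated; surjective∧separated⇒colimit)

      module Pres t = Presentability P directed D
        (presentable t P (λ J≺ → κ-directed (≺μ⇒≺κ J≺)) D d d-colimit)

      factorise : ∀ v → Σ[ r ∈ R ] Σ[ w ∈ (∀ t → Hom (E.F₀ t) (F₀ r)) ]
        (∀ t → leg′ r ∘ w t ≈ v ∘ leg t)
      factorise v =
        let r = λ t → Pres.factor t (v ∘ leg t)
            s , r≤s = κ-directed Q≺κ λ t → proj₁ (r t)
        in s , (λ t → F₁ (r≤s t) ∘ proj₁ (proj₂ (r t))) ,
           λ t → ≈-trans (pullˡ (commute′ (r≤s t))) (proj₂ (proj₂ (r t)))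

      module _ {v : Hom apex apex′} {r : R} (w : ∀ t → Hom (E.F₀ t) (F₀ r))
               (w-factors : ∀ t → leg′ r ∘ w t ≈ v ∘ leg t) where

        Commuting : Q.Carrier × Q.Carrier → R → Set ℓ
        Commuting (t , t′) s =
          Σ[ r≤s ∈ r ≤ s ] ((p : t Q.≤ t′) → F₁ r≤s ∘ w t′ ∘ E.F₁ p ≈ F₁ r≤s ∘ w t)

        commuting : ∀ tt′ → Σ R (Commuting tt′)
        commuting (t , t′) with em {P = t Q.≤ t′}
        -- There is nothing to commute here, so the stage `r` itself serves.
        ... | no t≰t′ = r , Poset.refl P , λ p → contradiction p t≰t′
        ... | yes p =
          let s , r≤s , eq = Pres.equalise t (w t′ ∘ E.F₁ p) (w t)
                (≈-trans (pullˡ (w-factors t′)) (≈-trans assoc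
                  (≈-trans (∘-congʳ (commute p)) (≈-sym (w-factors t)))))
          in s , r≤s , λ p′ → ≈-trans (∘-congʳ (∘-congʳ (F₁-thin Q E p′ p))) eq

        commuting-all : Σ[ s ∈ R ] Σ[ r≤s ∈ r ≤ s ] ∀ {t t′} (p : t Q.≤ t′) →
          F₁ r≤s ∘ w t′ ∘ E.F₁ p ≈ F₁ r≤s ∘ w t
        commuting-all =
          let s , ≤s = κ-directed Q²≺κ λ tt′ → proj₁ (commuting tt′)
              -- `s` bounds only the stages of pairs, and need not lie above `r` when `Q` is empty;
              -- `u` does.
              u , s≤u , r≤u = proj₂ directed s r
          in u , r≤u , λ {t} {t′} p →
               let q , r≤q , eq = commuting (t , t′)
                   split = F₁-through P D r≤q (≤-trans (≤s (t , t′)) s≤u) r≤u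
               in ≈-trans (∘-congˡ (≈-sym split)) (≈-trans assoc
                    (≈-trans (∘-congʳ (eq p)) (pullˡ split)))

        lift-factorisation : ∀ {s} (r≤s : r ≤ s) →
          (∀ {t t′} (p : t Q.≤ t′) → F₁ r≤s ∘ w t′ ∘ E.F₁ p ≈ F₁ r≤s ∘ w t) →
          Σ[ u ∈ Hom apex (F₀ s) ] leg′ s ∘ u ≈ v
        lift-factorisation {s} r≤s eq = universal e ,
          jointly-epic Q colimit λ t →
            ≈-trans assoc (≈-trans (∘-congʳ (factors e t))
              (≈-trans (pullˡ (commute′ r≤s)) (w-factors t)))
          where
          e : Cocone E
          e = record
            { apex    = F₀ s
            ; leg     = λ t → F₁ r≤s ∘ w t
            ; commute = λ p → ≈-trans assoc (eq p)
            }

      surj : JointlySurjective (mapCocone (HomFunctor K apex) d)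
      surj v =
        let r , w , w-factors = factorise v
            s , r≤s , eq = commuting-all w w-factors
        in s , lift-factorisation w w-factors r≤s eq

      sep : Separated (mapCocone (HomFunctor K apex) d)
      sep {i} u v eq =
        let r = λ t → Pres.equalise t (u ∘ leg t) (v ∘ leg t) (extendˡ eq)
            s , r≤s = κ-directed Q≺κ λ t → proj₁ (r t)
            k , i≤k , s≤k = proj₂ directed i s
        in k , i≤k , jointly-epic Q colimit λ t →
             let split = F₁-through P D (proj₁ (proj₂ (r t))) (≤-trans (r≤s t) s≤k) i≤k in
             ≈-trans assoc (≈-trans (∘-congˡ (≈-sym split)) (≈-trans assoc
               (≈-trans (∘-congʳ (proj₂ (proj₂ (r t)))) (≈-trans (pullˡ split) (≈-sym assoc)))))

-- Ultraproducts of presentations by generators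

module Accessible {o ℓ : Level} {K : Category o ℓ} {μ : Set ℓ}
                  (infinite : ℕ ↣ μ) (accessible : IsAccessibleFor μ K) where
  open Category K
  open Composition K
  open IsAccessibleFor accessible public
  open HomEq renaming (sym to ≈-sym; trans to ≈-trans; refl to ≈-refl)

  directedFor⇒directed : {κ : Set ℓ} → ℕ ↣ κ → (P : SmallPoset ℓ) → IsDirectedFor κ P → IsDirected P
  directedFor⇒directed {κ} inf P dir =
    proj₁ (dir (empty≺ inf) λ ()) , λ i j →
      let k , p = dir (Bool≺ inf) (λ { (lift true) → i ; (lift false) → j }) in
      k , p (lift true) , p (lift false)

  -- The objects of the diagram are generators on the nose, named by `index`, so that constancy of a
  -- diagram along a point can be stated as equality of indices.
  record Presentation (X : Obj) : Set (o ⊔ Level.suc ℓ) where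
    field
      poset       : SmallPoset ℓ
      directedFor : IsDirectedFor μ poset
    open Poset poset public using (_≤_) renaming (Carrier to Stage; refl to ≤-refl; trans to ≤-trans)
    field
      index    : Stage → Index
      arrow    : ∀ {p q} → p ≤ q → Hom (generator (index p)) (generator (index q))
      thin-eq  : ∀ {p q} (r s : p ≤ q) → arrow r ≈ arrow s
      arrow-id : ∀ {p} → arrow (≤-refl {p}) ≈ idn
      arrow-∘  : ∀ {p q r} (s : p ≤ q) (t : q ≤ r) → arrow (≤-trans s t) ≈ arrow t ∘ arrow s
      leg      : ∀ p → Hom (generator (index p)) X
      commute  : ∀ {p q} (r : p ≤ q) → leg q ∘ arrow r ≈ leg p

    diagram : Diagram poset K
    diagram = record
      { F₀     = λ p → generator (index p)
      ; F₁     = arrow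
      ; F-cong = λ {_} {_} {r} {s} _ → thin-eq r s
      ; F-id   = arrow-id
      ; F-∘    = λ {_} {_} {_} {s} {t} → arrow-∘ s t
      }

    cocone : Cocone diagram
    cocone = record { apex = X ; leg = leg ; commute = commute }

    field
      isColimit : IsColimit cocone

    directed : IsDirected poset
    directed = directedFor⇒directed infinite poset directedFor

    module Generator (a : Index) =
      Presentability poset directed diagram (presentable a poset directedFor diagram cocone isColimit)

    module Image (Φ : Functor K (Sets ℓ)) (preserved : IsColimit (mapCocone Φ cocone)) where
      open Functor Φ
      private
        module S {A} = Setoid (F₀ A)

        _∙_ : ∀ {A B} → Hom A B → S.Carrier {A} → S.Carrier {B}
        f ∙ x = F₁ f ⟨$⟩ x

      open SetColimit poset directed (Φ ∘F diagram)

      preimage : (x : S.Carrier {X}) →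
        Σ[ p ∈ Stage ] Σ[ y ∈ S.Carrier {generator (index p)} ] leg p ∙ y S.≈ x
      preimage = colimit⇒surjective preserved

      separate : ∀ {p} (x y : S.Carrier {generator (index p)}) → leg p ∙ x S.≈ leg p ∙ y →
        Σ[ k ∈ Stage ] Σ[ s ∈ p ≤ k ] arrow s ∙ x S.≈ arrow s ∙ y
      separate = colimit⇒separated preserved

      identified : ∀ {p q A B} (f : Hom A (generator (index p))) (g : Hom B (generator (index q)))
        (x : S.Carrier {A}) (y : S.Carrier {B}) → (leg p ∘ f) ∙ x S.≈ (leg q ∘ g) ∙ y →
        Σ[ k ∈ Stage ] Σ[ s ∈ p ≤ k ] Σ[ t ∈ q ≤ k ] (arrow s ∘ f) ∙ x S.≈ (arrow t ∘ g) ∙ y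
      identified {p} {q} f g x y eq =
        let k , s , t = proj₂ directed p q
            m , z , eq′ = separate ((arrow s ∘ f) ∙ x) ((arrow t ∘ g) ∙ y)
              (S.trans (S.sym (F-∘ x)) (S.trans (F-cong (pullˡ (commute s)) x)
                (S.trans eq (S.trans (S.sym (F-cong (pullˡ (commute t)) y)) (F-∘ y)))))
        in m , ≤-trans s z , ≤-trans t z ,
          S.trans (F-cong (≈-trans (∘-congˡ (arrow-∘ s z)) assoc) x)
            (S.trans (F-∘ x) (S.trans eq′ (S.trans (S.sym (F-∘ y))
              (S.sym (F-cong (≈-trans (∘-congˡ (arrow-∘ t z)) assoc) y)))))

  -- The diagram from `generates` is conjugated by the isomorphisms of its objects with generators
  -- and of its apex with `X`.
  presentation : ∀ X → Presentation X
  presentation X with generates X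
  ... | P , dir , D , iso , c , colimit , apex≅X = record
    { poset       = P
    ; directedFor = dir
    ; index       = λ i → proj₁ (iso i)
    ; arrow       = λ {i} {j} p → φ j ∘ F₁ p ∘ φ⁻¹ i
    ; thin-eq     = λ p q → ∘-congʳ (∘-congˡ (F₁-thin P D p q))
    ; arrow-id    = ≈-trans (∘-congʳ (≈-trans (∘-congˡ F-id) identityˡ)) (_≅_.isoʳ (proj₂ (iso _)))
    ; arrow-∘     = λ {i} {j} {k} p q →
        ≈-trans (∘-congʳ (≈-trans (∘-congˡ F-∘) assoc))
          (≈-sym (≈-trans assoc (∘-congʳ (≈-trans assoc (∘-congʳ (cancelˡ (_≅_.isoˡ (proj₂ (iso j)))))))))
    ; leg         = λ i → ψ ∘ leg i ∘ φ⁻¹ i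
    ; commute     = λ {i} {j} p →
        ≈-trans assoc (∘-congʳ (≈-trans assoc
          (≈-trans (∘-congʳ (cancelˡ (_≅_.isoˡ (proj₂ (iso j))))) (pullˡ (commute p)))))
    ; isColimit   = record
      { universal = λ d → universal (conjugate d) ∘ ψ⁻¹
      ; factors   = λ d i →
          ≈-trans assoc (≈-trans (∘-congʳ (cancelˡ (_≅_.isoˡ apex≅X)))
            (≈-trans (pullˡ (factors (conjugate d) i))
              (≈-trans assoc (≈-trans (∘-congʳ (_≅_.isoʳ (proj₂ (iso i)))) identityʳ))))
      ; unique    = λ d h eq →
          ≈-trans (≈-sym (≈-trans assoc (≈-trans (∘-congʳ (_≅_.isoʳ apex≅X)) identityʳ)))
            (∘-congˡ (unique (conjugate d) (h ∘ ψ) λ i →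
              ≈-trans assoc
                (≈-trans (∘-congʳ (∘-congʳ (≈-sym (leg-φ i))))
                  (≈-trans (≈-sym (≈-trans assoc (∘-congʳ (≈-trans assoc (∘-congʳ assoc)))))
                    (∘-congˡ (eq i))))))
      }
    }
    where
    open Functor D
    open Cocone c
    open IsColimit colimit
    φ : ∀ i → Hom (F₀ i) (generator (proj₁ (iso i)))
    φ i = _≅_.to (proj₂ (iso i))
    φ⁻¹ : ∀ i → Hom (generator (proj₁ (iso i))) (F₀ i)
    φ⁻¹ i = _≅_.from (proj₂ (iso i))
    ψ = _≅_.to apex≅X
    ψ⁻¹ = _≅_.from apex≅X

    leg-φ : ∀ i → leg i ∘ φ⁻¹ i ∘ φ i ≈ leg i
    leg-φ i = ≈-trans (∘-congʳ (_≅_.isoˡ (proj₂ (iso i)))) identityʳ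

    conjugate : Cocone _ → Cocone D
    conjugate d = record
      { apex    = Cocone.apex d
      ; leg     = λ i → Cocone.leg d i ∘ φ i
      ; commute = λ {i} {j} p →
          ≈-trans assoc (≈-trans (∘-congʳ
            (≈-sym (≈-trans assoc (∘-congʳ (≈-trans assoc
              (≈-trans (∘-congʳ (_≅_.isoˡ (proj₂ (iso i)))) identityʳ))))))
            (pullˡ (Cocone.commute d p)))
      }

module Ultraproduct {o ℓ : Level} (em : {a : Level} → ExcludedMiddle a)
  {K : Category o ℓ} {μ : Set ℓ} (infinite : ℕ ↣ μ) (accessible : IsAccessibleFor μ K)
  {κ I : Set ℓ} (G : Filter I) (ultra : IsUltrafilter G) (complete : IsComplete κ G)
  (Index≺κ : IsAccessibleFor.Index accessible ≺ κ)
  (Hom≺κ : ∀ a b → Category.Hom K (IsAccessibleFor.generator accessible a)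
                                  (IsAccessibleFor.generator accessible b) ≺ κ)
  {N : I → Category.Obj K} (pres : ∀ i → Accessible.Presentation infinite accessible (N i))
  where
  open Category K
  open Accessible infinite accessible
  open Classical em
  open Composition K
  open HomEq renaming (sym to ≈-sym; trans to ≈-trans; refl to ≈-refl)
  open Filter G using (full; proper; upward; ∩-closed)
  private
    module P i = Presentation (pres i)

  everywhere : {X : Pred I ℓ} → (∀ i → X i) → X ∈ Member G
  everywhere h = upward (λ {i} _ → h i) full

  inhabited : {X : Pred I ℓ} → X ∈ Member G → Σ I X
  inhabited X∈G = dne λ empty → proper (upward (λ {i} x → contradiction (i , x) empty) X∈G)

  -- If no `y` worked, the complements would all be in `G` as it is an ultrafilter; by completeness
  -- their intersection would be too, yet it is disjoint from the given set.
  pigeonhole : {Y : Set ℓ} → Y ≺ κ → (R : I → Y → Set ℓ) →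
    (λ i → Σ Y (R i)) ∈ Member G → Σ[ y ∈ Y ] (λ i → R i y) ∈ Member G
  pigeonhole {Y} Y≺κ R R∈G = dne λ none →
    let i , (y , r) , avoids = inhabited (∩-closed R∈G (complete Y≺κ _ (avoided none)))
    in avoids y r
    where
    avoided : ¬ (Σ[ y ∈ Y ] (λ i → R i y) ∈ Member G) → ∀ y → ∁ (λ i → R i y) ∈ Member G
    avoided none y with ultra (λ i → R i y)
    ... | inj₁ R∈ = contradiction (y , R∈) none
    ... | inj₂ ∁R∈ = ∁R∈

  -- Transport along an equality of indices, as a morphism, so that it can be composed with arrows
  -- at varying stages.
  θ : ∀ {a b} → a ≡ b → Hom (generator b) (generator a)
  θ refl = idn

  θ⁻¹ : ∀ {a b} → a ≡ b → Hom (generator a) (generator b)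
  θ⁻¹ refl = idn

  θ∘θ⁻¹ : ∀ {a b} (e : a ≡ b) → θ e ∘ θ⁻¹ e ≈ idn
  θ∘θ⁻¹ refl = identityˡ

  θ-irr : ∀ {a b} (e e′ : a ≡ b) → θ e ≈ θ e′
  θ-irr e e′ with uip e e′
  ... | refl = ≈-refl

  θ-monic : ∀ {a b X} (e : a ≡ b) {f g : Hom X (generator b)} → θ e ∘ f ≈ θ e ∘ g → f ≈ g
  θ-monic refl p = ≈-trans (≈-sym identityˡ) (≈-trans p identityˡ)

  Point : Set ℓ
  Point = ∀ i → P.Stage i

  infix 4 _≼_

  _≼_ : Point → Point → Set ℓ
  p ≼ q = (λ i → P._≤_ i (p i) (q i)) ∈ Member G

  ≼-refl : ∀ {p} → p ≼ p
  ≼-refl = everywhere λ i → P.≤-refl i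

  ≼-trans : ∀ {p q r} → p ≼ q → q ≼ r → p ≼ r
  ≼-trans s t = upward (λ {i} (s , t) → P.≤-trans i s t) (∩-closed s t)

  stages : SmallPoset ℓ
  stages = record
    { Carrier = Point
    ; _≈_ = λ p q → p ≼ q × q ≼ p
    ; _≤_ = _≼_
    ; isPartialOrder = record
      { isPreorder = record
        { isEquivalence = record
          { refl  = λ {p} → ≼-refl {p} , ≼-refl {p}
          ; sym   = λ (s , t) → t , s
          ; trans = λ {p} {q} {r} (s , t) (s′ , t′) →
              ≼-trans {p} {q} {r} s s′ , ≼-trans {r} {q} {p} t′ t
          }
        ; reflexive = proj₁
        ; trans = λ {p} {q} {r} → ≼-trans {p} {q} {r}
        }
      ; antisym = _,_
      }
    }

  stages-directed : IsDirectedFor μ stages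
  stages-directed J≺μ x =
    (λ i → proj₁ (P.directedFor i J≺μ λ j → x j i)) ,
    λ j → everywhere λ i → proj₂ (P.directedFor i J≺μ λ j → x j i) j

  index-constant : ∀ (p : Point) → Σ[ a ∈ Index ] (λ i → P.index i (p i) ≡ a) ∈ Member G
  index-constant p = pigeonhole Index≺κ (λ i a → P.index i (p i) ≡ a)
    (everywhere λ i → P.index i (p i) , refl)

  index : Point → Index
  index p = proj₁ (index-constant p)

  At : Point → Pred I ℓ
  At p i = P.index i (p i) ≡ index p

  -- `u` is the arrow from `p i` to `q i` read between the constant generators. The first factor
  -- keeps the equation from holding vacuously; quantifying over all proofs makes it independent of
  -- their choice.
  Tracks : ∀ p q → Hom (generator (index p)) (generator (index q)) → Pred I ℓ
  Tracks p q u i = (At p i × At q i × P._≤_ i (p i) (q i)) ×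
    ((e : At p i) (e′ : At q i) (r : P._≤_ i (p i) (q i)) → P.arrow i r ∘ θ e ≈ θ e′ ∘ u)

  arrow-constant : ∀ p q → p ≼ q →
    Σ[ u ∈ Hom (generator (index p)) (generator (index q)) ] Tracks p q u ∈ Member G
  arrow-constant p q p≼q = pigeonhole (Hom≺κ (index p) (index q)) (λ i u → Tracks p q u i)
    -- The value at a good coordinate is its arrow conjugated by the transports.
    (upward (λ {i} (e , e′ , r) → (θ⁻¹ e′ ∘ P.arrow i r ∘ θ e) , (e , e′ , r) ,
        λ d d′ s → ≈-trans (∘-cong (P.thin-eq i s r) (θ-irr d e))
          (≈-sym (≈-trans (∘-congˡ (θ-irr d′ e′)) (cancelˡ (θ∘θ⁻¹ e′)))))
      (∩-closed (proj₂ (index-constant p)) (∩-closed (proj₂ (index-constant q)) p≼q)))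

  arrow : ∀ {p q} → p ≼ q → Hom (generator (index p)) (generator (index q))
  arrow {p} {q} p≼q = proj₁ (arrow-constant p q p≼q)

  arrow-tracks : ∀ {p q} (p≼q : p ≼ q) → Tracks p q (arrow p≼q) ∈ Member G
  arrow-tracks {p} {q} p≼q = proj₂ (arrow-constant p q p≼q)

  -- Two sets of the filter share a coordinate, and one coordinate decides the equation because `θ`
  -- is monic. Functoriality of `ultradiagram` thus reduces to almost everywhere statements.
  tracks-unique : ∀ {p q u v} → Tracks p q u ∈ Member G → Tracks p q v ∈ Member G → u ≈ v
  tracks-unique s t =
    let i , ((e , e′ , r) , eq) , (_ , eq′) = inhabited (∩-closed s t)
    in θ-monic e′ (≈-trans (≈-sym (eq e e′ r)) (eq′ e e′ r))

  tracks-id : ∀ p → Tracks p p idn ∈ Member G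
  tracks-id p = upward (λ {i} e → (e , e , P.≤-refl i) , λ d d′ r →
      ≈-trans (∘-cong (≈-trans (P.thin-eq i r _) (P.arrow-id i)) (θ-irr d d′))
        (≈-trans identityˡ (≈-sym identityʳ)))
    (proj₂ (index-constant p))

  tracks-∘ : ∀ {p q r u v} → Tracks p q u ∈ Member G → Tracks q r v ∈ Member G →
    Tracks p r (v ∘ u) ∈ Member G
  tracks-∘ s t = upward
    (λ {i} (((e , e′ , x) , eq) , ((_ , e″ , y) , eq′)) →
      (e , e″ , P.≤-trans i x y) , λ d d″ z →
        ≈-trans (∘-congˡ (≈-trans (P.thin-eq i z _) (P.arrow-∘ i x y)))
          (≈-trans assoc (≈-trans (∘-congʳ (eq d e′ x)) (extendˡ (eq′ e′ d″ y)))))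
    (∩-closed s t)

  ultradiagram : Diagram stages K
  ultradiagram = record
    { F₀     = λ p → generator (index p)
    ; F₁     = arrow
    ; F-cong = λ {_} {_} {s} {t} _ → tracks-unique (arrow-tracks s) (arrow-tracks t)
    ; F-id   = λ {p} → tracks-unique (arrow-tracks (≼-refl {p})) (tracks-id p)
    ; F-∘    = λ {p} {q} {r} {s} {t} → tracks-unique (arrow-tracks (≼-trans {p} {q} {r} s t))
        (tracks-∘ {p} {q} {r} (arrow-tracks s) (arrow-tracks t))
    }

  ultraproduct : Σ[ c ∈ Cocone ultradiagram ] IsColimit c
  ultraproduct = colimits stages stages-directed ultradiagram

  open Cocone (proj₁ ultraproduct) public
    renaming (apex to N∞; leg to ι; commute to ι-commute)

  -- For Φ = K(X, −) this makes maps into the ultraproduct well defined; for Φ = U it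
  -- transfers coincidences of elements.
  module _ (Φ : Functor K (Sets ℓ)) (preserves : ∀ i → IsColimit (mapCocone Φ (P.cocone i))) where
    open Functor Φ
    private
      module S {A} = Setoid (F₀ A)

      _∙_ : ∀ {A B} → Hom A B → S.Carrier {A} → S.Carrier {B}
      f ∙ x = F₁ f ⟨$⟩ x

      ∙-cancel : ∀ {a b X Y} (e : a ≡ b) {f : Hom X (generator b)} {g : Hom Y (generator b)} {x y} →
        (θ e ∘ f) ∙ x S.≈ (θ e ∘ g) ∙ y → f ∙ x S.≈ g ∙ y
      ∙-cancel refl {x = x} {y} p =
        S.trans (F-cong (≈-sym identityˡ) x) (S.trans p (F-cong identityˡ y))

    module _ {p q : Point} (x : S.Carrier {generator (index p)})
             (y : S.Carrier {generator (index q)}) where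

      Coincide : Pred I ℓ
      Coincide i = (At p i × At q i) ×
        ((e : At p i) (e′ : At q i) → (P.leg i (p i) ∘ θ e) ∙ x S.≈ (P.leg i (q i) ∘ θ e′) ∙ y)

      -- The equation is conditional on `Coincide` so that a stage exists at every coordinate: at
      -- the exceptional ones any common upper bound will do.
      Meet : ∀ i → P.Stage i → Set ℓ
      Meet i k = Σ[ s ∈ P._≤_ i (p i) k ] Σ[ t ∈ P._≤_ i (q i) k ]
        (Coincide i → (e : At p i) (e′ : At q i) →
          (P.arrow i s ∘ θ e) ∙ x S.≈ (P.arrow i t ∘ θ e′) ∙ y)

      meet : ∀ i → Σ (P.Stage i) (Meet i)
      meet i with em {P = Coincide i}
      ... | no ¬c =
        let k , s , t = proj₂ (P.directed i) (p i) (q i)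
        in k , s , t , λ c → contradiction c ¬c
      ... | yes ((e , e′) , eq) =
        let k , s , t , eq′ = P.Image.identified i Φ (preserves i) (θ e) (θ e′) x y (eq e e′)
        in k , s , t , λ _ d d′ →
          S.trans (F-cong (∘-congʳ (θ-irr d e)) x)
            (S.trans eq′ (F-cong (∘-congʳ (θ-irr e′ d′)) y))

      module _ (r : Point) (meets : ∀ i → Meet i (r i)) (coincide : Coincide ∈ Member G) where
        p≼r : p ≼ r
        p≼r = everywhere λ i → proj₁ (meets i)

        q≼r : q ≼ r
        q≼r = everywhere λ i → proj₁ (proj₂ (meets i))

        -- Both sides live at one fixed generator, so it suffices to compare them at a single
        -- coordinate where `x` and `y` coincide and both arrows are tracked.
        arrows-agree : arrow {p} {r} p≼r ∙ x S.≈ arrow {q} {r} q≼r ∙ y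
        arrows-agree =
          let i , c , ((e , d , s) , eq) , ((e′ , _ , t) , eq′) =
                inhabited (∩-closed coincide (∩-closed (arrow-tracks {p} {r} p≼r) (arrow-tracks {q} {r} q≼r)))
              s′ , t′ , same = meets i
          in ∙-cancel d (S.trans (S.sym (F-cong (eq e d s′) x))
               (S.trans (same c e e′) (F-cong (eq′ e′ d t′) y)))

        agree-above : ι p ∙ x S.≈ ι q ∙ y
        agree-above =
          S.trans (S.sym (F-cong (ι-commute {p} {r} p≼r) x))
            (S.trans (F-∘ x) (S.trans (Func.cong (F₁ (ι r)) arrows-agree)
              (S.trans (S.sym (F-∘ y)) (F-cong (ι-commute {q} {r} q≼r) y))))

      agree : Coincide ∈ Member G → ι p ∙ x S.≈ ι q ∙ y
      agree = agree-above (λ i → proj₁ (meet i)) (λ i → proj₂ (meet i))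

  Represents : ∀ {c} → (∀ i → Hom (generator c) (N i)) →
    ∀ p → Hom (generator c) (generator (index p)) → Set ℓ
  Represents v p w = (λ i → At p i × ((e : At p i) → P.leg i (p i) ∘ θ e ∘ w ≈ v i)) ∈ Member G

  -- Presentability of the generator factors each `v i` through a stage. These stages form a point,
  -- and pigeonhole over fewer than `κ` morphisms makes the factor constant almost everywhere.
  represent : ∀ {c} (v : ∀ i → Hom (generator c) (N i)) →
    Σ[ p ∈ Point ] Σ[ w ∈ _ ] Represents v p w
  represent {c} v = p , pigeonhole (Hom≺κ c (index p)) _
    (upward (λ {i} e → (θ⁻¹ e ∘ proj₁ (proj₂ (factored i))) , e , λ d →
        ≈-trans (∘-congʳ (≈-trans (∘-congˡ (θ-irr d e)) (cancelˡ (θ∘θ⁻¹ e))))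
          (proj₂ (proj₂ (factored i))))
      (proj₂ (index-constant p)))
    where
    factored : ∀ i → Σ[ k ∈ P.Stage i ] Σ[ u ∈ _ ] P.leg i k ∘ u ≈ v i
    factored i = P.Generator.factor i c (v i)

    p : Point
    p i = proj₁ (factored i)

  represents-∘ : ∀ {c c′ v p w} (t : Hom (generator c′) (generator c)) →
    Represents v p w → Represents (λ i → v i ∘ t) p (w ∘ t)
  represents-∘ t = upward λ (e , eq) → e , λ d →
    ≈-trans (∘-congʳ (≈-sym assoc)) (pullˡ (eq d))

  represents-cong : ∀ {c} {v v′ : ∀ i → Hom (generator c) (N i)} {p w} →
    (λ i → v i ≈ v′ i) ∈ Member G → Represents v p w → Represents v′ p w
  represents-cong same rep =
    upward (λ (s , e , eq) → e , λ d → ≈-trans (eq d) s) (∩-closed same rep)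

  represents-unique : ∀ {c} {v : ∀ i → Hom (generator c) (N i)} {p q w w′} →
    Represents v p w → Represents v q w′ → ι p ∘ w ≈ ι q ∘ w′
  represents-unique {c} {p = p} {q} {w} {w′} r r′ =
    agree (HomFunctor K (generator c))
      (λ i → presentable c (P.poset i) (P.directedFor i) (P.diagram i) (P.cocone i) (P.isColimit i))
      {p} {q} w w′
      (upward (λ ((e , eq) , (e′ , eq′)) → (e , e′) , λ d d′ →
          ≈-trans assoc (≈-trans (eq d) (≈-sym (≈-trans assoc (eq′ d′)))))
        (∩-closed r r′))

  module Limit {L : Obj} (pL : Presentation L) (h : ∀ i → Hom L (N i)) where
    private
      module L = Presentation pL

      at : ∀ q → Σ[ p ∈ Point ] Σ[ w ∈ _ ] Represents (λ i → h i ∘ L.leg q) p w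
      at q = represent (λ i → h i ∘ L.leg q)

    limitCocone : Cocone L.diagram
    limitCocone = record
      { apex    = N∞
      ; leg     = λ q → let p , w , _ = at q in ι p ∘ w
      ; commute = λ {q} {q′} s →
          let p  , w  , r  = at q
              p′ , w′ , r′ = at q′
          in ≈-trans assoc (represents-unique {p = p′} {p}
               (represents-cong {p = p′} (everywhere λ i → ≈-trans assoc (∘-congʳ (L.commute s)))
                 (represents-∘ {p = p′} (L.arrow s) r′)) r)
      }

    limit : Hom L N∞
    limit = IsColimit.universal L.isColimit limitCocone

    -- The value of `limit` may be computed from any representation: `t` factors through a stage of
    -- `L`, and the representation chosen there, composed with the factor, represents the same
    -- family.
    limit-represented : ∀ {c p w} (t : Hom (generator c) L) →
      Represents (λ i → h i ∘ t) p w → limit ∘ t ≈ ι p ∘ w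
    limit-represented {c} {p} t r =
      let q , u , leg∘u≈t = L.Generator.factor c t
          p′ , w′ , r′ = at q
      in ≈-trans (∘-congʳ (≈-sym leg∘u≈t)) (≈-trans (pullˡ (IsColimit.factors L.isColimit limitCocone q))
           (≈-trans assoc (represents-unique {p = p′} {p}
             (represents-cong {p = p′} (everywhere λ i → ≈-trans assoc (∘-congʳ leg∘u≈t))
               (represents-∘ {p = p′} u r′)) r)))

  open Limit public

  -- The legs into `A` are jointly epic, so each leg may use its own set of coordinates. Where the
  -- two families agree, one representation serves both sides.
  limit-agree : ∀ {A L L′} (pA : Presentation A) (pL : Presentation L) (pL′ : Presentation L′)
    (h : ∀ i → Hom L (N i)) (h′ : ∀ i → Hom L′ (N i)) (f : Hom A L) (g : Hom A L′) →
    (∀ q → (λ i → h i ∘ f ∘ Presentation.leg pA q ≈ h′ i ∘ g ∘ Presentation.leg pA q) ∈ Member G) →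
    limit pL h ∘ f ≈ limit pL′ h′ ∘ g
  limit-agree pA pL pL′ h h′ f g same = jointly-epic A.poset A.isColimit λ q →
    let p , w , r = represent (λ i → h i ∘ f ∘ A.leg q) in
    ≈-trans assoc (≈-trans (limit-represented pL h {p = p} (f ∘ A.leg q) r)
      (≈-sym (≈-trans assoc (limit-represented pL′ h′ {p = p} (g ∘ A.leg q)
        (represents-cong {p = p} (same q) r)))))
    where module A = Presentation pA

  -- Both elements come from generators at stages of `L` and `L′`. Representing the composites with
  -- `h` and `h′` there reduces the claim to `agree` for `U`.
  limit-identify : (U : Functor K (Sets ℓ)) →
    (∀ {L} (pL : Presentation L) → IsColimit (mapCocone U (Presentation.cocone pL))) →
    ∀ {L L′} (pL : Presentation L) (pL′ : Presentation L′)
      (h : ∀ i → Hom L (N i)) (h′ : ∀ i → Hom L′ (N i)) x y →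
    (∀ i → Setoid._≈_ (Functor.F₀ U (N i)) (Functor.F₁ U (h i) ⟨$⟩ x) (Functor.F₁ U (h′ i) ⟨$⟩ y)) →
    Setoid._≈_ (Functor.F₀ U N∞) (Functor.F₁ U (limit pL h) ⟨$⟩ x) (Functor.F₁ U (limit pL′ h′) ⟨$⟩ y)
  limit-identify U preserves pL pL′ h h′ x y same =
    let q  , x₀ , eqx = Presentation.Image.preimage pL U (preserves pL) x
        q′ , y₀ , eqy = Presentation.Image.preimage pL′ U (preserves pL′) y
        v  = λ i → h i ∘ Presentation.leg pL q
        v′ = λ i → h′ i ∘ Presentation.leg pL′ q′
        p  , w  , r  = represent v
        p′ , w′ , r′ = represent v′
    in S.trans (descend (limit pL h) x₀ eqx (limit-represented pL h {p = p} _ r))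
         (S.trans (agree U (λ i → preserves (pres i)) {p} {p′} (F₁ w ⟨$⟩ x₀) (F₁ w′ ⟨$⟩ y₀)
           (upward (λ {i} ((e , eq) , (e′ , eq′)) → (e , e′) , λ d d′ →
               S.trans (S.sym (descend (h i) x₀ eqx (≈-sym (≈-trans assoc (eq d)))))
                 (S.trans (same i) (descend (h′ i) y₀ eqy (≈-sym (≈-trans assoc (eq′ d′))))))
             (∩-closed r r′)))
           (S.sym (descend (limit pL′ h′) y₀ eqy (limit-represented pL′ h′ {p = p′} _ r′))))
    where
    open Functor U
    module S {A} = Setoid (F₀ A)

    descend : ∀ {A B C D} (f : Hom A B) {g : Hom C A} {k : Hom D B} {l : Hom C D}
      (z₀ : S.Carrier) {z} → F₁ g ⟨$⟩ z₀ S.≈ z → f ∘ g ≈ k ∘ l →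
      F₁ f ⟨$⟩ z S.≈ F₁ k ⟨$⟩ (F₁ l ⟨$⟩ z₀)
    descend f z₀ eq fg≈kl = S.trans (Func.cong (F₁ f) (S.sym eq))
      (S.trans (S.sym (F-∘ z₀)) (S.trans (F-cong fg≈kl z₀) (F-∘ z₀)))

  limit-equivalent : (U : Functor K (Sets ℓ)) →
    (∀ {L} (pL : Presentation L) → IsColimit (mapCocone U (Presentation.cocone pL))) →
    ∀ {M} (pM : Presentation M) (s t : TypeOver K U M) →
    Presentation (TypeOver.target s) → Presentation (TypeOver.target t) →
    (h : ∀ i → Hom (TypeOver.target s) (N i)) (h′ : ∀ i → Hom (TypeOver.target t) (N i)) →
    (∀ q → (λ i → h i ∘ TypeOver.mor s ∘ Presentation.leg pM q ≈
                  h′ i ∘ TypeOver.mor t ∘ Presentation.leg pM q) ∈ Member G) →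
    (∀ i → Setoid._≈_ (Functor.F₀ U (N i))
      (Functor.F₁ U (h i) ⟨$⟩ TypeOver.elem s) (Functor.F₁ U (h′ i) ⟨$⟩ TypeOver.elem t)) →
    Equivalent K U s t
  limit-equivalent U preserves pM s t ps pt h h′ same identify = record
    { h₀       = limit ps h
    ; h₁       = limit pt h′
    ; agree    = limit-agree pM ps pt h h′ (TypeOver.mor s) (TypeOver.mor t) same
    ; identify = limit-identify U preserves ps pt h h′ (TypeOver.elem s) (TypeOver.elem t) identify
    }

-- Approximating an object by small colimits of generators

-- Terms for the elements generated by A under upper bounds of fewer than μ
-- elements; the type depends only on A and μ, which bounds uniformly the size of
-- the μ-directed subposets generated by A-indexed families.
data Closure {ℓ : Level} (A μ : Set ℓ) : Set ℓ where
  leaf : A → Closure A μ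
  node : (S : μ → Bool) → (Σ[ m ∈ μ ] S m ≡ true) ≺ μ →
         (Σ[ m ∈ μ ] S m ≡ true → Closure A μ) → Closure A μ

module Generated {ℓ : Level} (em : {a : Level} → ExcludedMiddle a) {A μ : Set ℓ}
                 (P : SmallPoset ℓ) (directed : IsDirectedFor μ P)
                 (z : A → Poset.Carrier P) where

  eval : Closure A μ → Poset.Carrier P
  eval (leaf x)       = z x
  eval (node S S≺μ x) = proj₁ (directed S≺μ λ s → eval (x s))

  -- Pulling the order back along `eval` keeps the type of terms as carrier, at the price of several
  -- terms for one stage; the size bound is then immediate.
  generated : SmallPoset ℓ
  generated = On.poset P eval

  -- A family over `J` is reindexed by the image of `J` in `μ`, a Boolean subset: `node` takes only
  -- such indices, which keeps the terms in `Set ℓ`.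
  generated-directed : IsDirectedFor μ generated
  generated-directed {J} (i , μ↣̸J) x =
    node S S≺μ (λ s → x (source s)) ,
    λ j → subst (λ k → Poset._≤_ P (eval (x k)) _) (source-to j)
      (proj₂ (directed S≺μ λ s → eval (x (source s))) (to i j , dec-true em (j , refl)))
    where
    S : μ → Bool
    S m = does (em {P = ∃[ j ] to i j ≡ m})

    source : Σ[ m ∈ μ ] S m ≡ true → J
    source (m , p) = proj₁ (does-true em p)

    to-source : ∀ s → to i (source s) ≡ proj₁ s
    to-source (m , p) = proj₂ (does-true em p)

    source-to : ∀ j {p} → source (to i j , p) ≡ j
    source-to j {p} = injective i (to-source (to i j , p))

    proj₁-injective : {s t : Σ[ m ∈ μ ] S m ≡ true} → proj₁ s ≡ proj₁ t → s ≡ t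
    proj₁-injective {m , p} {_ , q} refl = cong (m ,_) (uip p q)

    S≺μ : (Σ[ m ∈ μ ] S m ≡ true) ≺ μ
    S≺μ = mk↣ proj₁-injective , λ f → μ↣̸J (↣-trans f (mk↣ λ {s} {t} p →
      proj₁-injective (trans (sym (to-source s)) (trans (cong (to i) p) (to-source t)))))

-- The filter of covering families.

module Covering {ℓ : Level} (em : {a : Level} → ExcludedMiddle a) {κ S : Set ℓ} (s₀ : S) where

  infix 4 _⊒_

  -- Inclusion of ranges. Lists serve as indices because `k ∷ l` combines an element of `κ` with
  -- another index.
  _⊒_ : (z z′ : List κ → S) → Set ℓ
  z ⊒ z′ = ∀ l → ∃[ l′ ] z l′ ≡ z′ l

  ⊒-trans : ∀ {z z′ z″} → z ⊒ z′ → z′ ⊒ z″ → z ⊒ z″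
  ⊒-trans p q l = let l′ , eq = q l; l″ , eq′ = p l′ in l″ , trans eq′ eq

  -- Entry `l` of family `j` is stored at `to i j ∷ l`; all other places receive `s₀`.
  merge : {J : Set ℓ} → J ↣ κ → (x : J → List κ → S) → ∃[ z ] (∀ j → z ⊒ x j)
  merge {J} i x = z , λ j l → to i j ∷ l , component-to j l em
    where
    component : ∀ {k} → Dec (∃[ j ] to i j ≡ k) → List κ → S
    component (yes (j , _)) = x j
    component (no _)        = λ _ → s₀

    component-to : ∀ j l (d : Dec (∃[ j′ ] to i j′ ≡ to i j)) → component d l ≡ x j l
    component-to j l (yes (j′ , p)) = cong (λ k → x k l) (injective i p)
    component-to j l (no ¬p)        = contradiction (j , refl) ¬p

    z : List κ → S
    z []      = s₀
    z (k ∷ l) = component {k} em l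

  module _ (infinite : ℕ ↣ κ) where

    coverFilter : Filter (List κ → S)
    coverFilter = record
      { Member   = λ X → Σ[ z ∈ (List κ → S) ] (∀ {z′} → z′ ⊒ z → X z′)
      ; full     = (λ _ → s₀) , λ _ → tt
      ; proper   = λ (z , h) → Empty.⊥-elim (h {z} λ l → l , refl)
      ; upward   = λ X⊆Y (z , h) → z , λ p → X⊆Y (h p)
      ; ∩-closed = λ (z , h) (z′ , h′) →
          let u , p = merge (proj₁ (Bool≺ infinite)) (λ { (lift true) → z ; (lift false) → z′ })
          in u , λ q → h (⊒-trans q (p (lift true))) , h′ (⊒-trans q (p (lift false)))
      }

    coverFilter-complete : IsComplete κ coverFilter
    coverFilter-complete (i , _) X X∈ =
      let z , p = merge i λ j → proj₁ (X∈ j)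
      in z , λ q j → proj₂ (X∈ j) (⊒-trans q (p j))

-- Tameness at the successor cardinal.

module Tameness {o ℓ : Level} (em : {a : Level} → ExcludedMiddle a) (ac : AxiomOfChoice ℓ)
  (K : Category o ℓ) (U : Functor K (Sets ℓ))
  {μ : Set ℓ} (infinite : ℕ ↣ μ) (accessible : IsAccessibleFor μ K)
  (preservesDirected : (P : SmallPoset ℓ) → IsDirected P → PreservesColimits U P)
  {κ : Set ℓ} (compact : IsStronglyCompact κ) (μ↣κ : μ ↣ κ)
  (Index≺κ : IsAccessibleFor.Index accessible ≺ κ)
  (Hom≺κ : ∀ a b → Category.Hom K (IsAccessibleFor.generator accessible a)
                                  (IsAccessibleFor.generator accessible b) ≺ κ)
  where
  open Category K
  open Accessible infinite accessible
  open Classical em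
  open Composition K
  open HomEq renaming (sym to ≈-sym; trans to ≈-trans; refl to ≈-refl)

  -- The common carrier of all generated subposets, whatever `M` and `z` are; `κ⁺` can therefore be
  -- fixed before `M`.
  T : Set ℓ
  T = Closure (List κ) μ

  open Successor em ac T using (κ⁺; κ⁺-regular; ≺κ⁺; ×≺κ⁺)

  μ↣T : μ ↣ T
  μ↣T = ↣-trans μ↣κ (mk↣ {to = λ k → leaf (k ∷ [])} λ { refl → refl })

  module Approximation {M : Obj} (pM : Presentation M) (z : List κ → Presentation.Stage pM) where
    open Presentation pM
    open Generated em poset directedFor z public

    subdiagram : Diagram generated K
    subdiagram = record
      { F₀     = λ t → generator (index (eval t))
      ; F₁     = arrow
      ; F-cong = λ {_} {_} {r} {s} _ → thin-eq r s
      ; F-id   = arrow-id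
      ; F-∘    = λ {_} {_} {_} {s} {t} → arrow-∘ s t
      }

    subcolimit : Σ[ c ∈ Cocone subdiagram ] IsColimit c
    subcolimit = colimits generated generated-directed subdiagram

    X : Obj
    X = Cocone.apex (proj₁ subcolimit)

    X-presentable : IsPresentable κ⁺ K X
    X-presentable = small-colimit-presentable em
      (λ J≺μ → ≺κ⁺ (↣-trans (proj₁ J≺μ) μ↣T))
      (directedFor⇒directed (IsRegular.infinite κ⁺-regular))
      {Q = generated} (≺κ⁺ (mk↣ id)) ×≺κ⁺ subdiagram
      (λ t → presentable (index (eval t))) (proj₂ subcolimit)

    restricted : Cocone subdiagram
    restricted = record { apex = M ; leg = λ t → leg (eval t) ; commute = commute }

    inclusion : Hom X M
    inclusion = IsColimit.universal (proj₂ subcolimit) restricted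

    leg-through : ∀ l → inclusion ∘ Cocone.leg (proj₁ subcolimit) (leaf l) ≈ leg (z l)
    leg-through l = IsColimit.factors (proj₂ subcolimit) restricted (leaf l)

  U-preserves : ∀ {L} (p : Presentation L) → IsColimit (mapCocone U (Presentation.cocone p))
  U-preserves p = preservesDirected poset directed diagram cocone isColimit
    where open Presentation p

  module _ {M : Obj} (s t : TypeOver K U M) where
    private
      module s = TypeOver s
      module t = TypeOver t

      pM = presentation M
      module M = Presentation pM
      module A z = Approximation pM z
      open Covering em {κ} (proj₁ M.directed)

      κ-infinite : ℕ ↣ κ
      κ-infinite = ↣-trans infinite μ↣κ

    module _ (equivalent : ∀ z → Equivalent K U (restrict K U (A.inclusion z) s)
                                                (restrict K U (A.inclusion z) t)) where
      private
        module E z = Equivalent (equivalent z)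

        extension = compact (List κ → M.Stage) (coverFilter κ-infinite)
                      (coverFilter-complete κ-infinite)
        G = proj₁ extension

      open Ultraproduct em infinite accessible G (proj₁ (proj₂ extension))
        (proj₁ (proj₂ (proj₂ extension))) Index≺κ Hom≺κ (λ z → presentation (E.N z))

      agree-on-leg : ∀ z l → E.h₀ z ∘ s.mor ∘ M.leg (z l) ≈ E.h₁ z ∘ t.mor ∘ M.leg (z l)
      agree-on-leg z l =
        ≈-trans (through (E.h₀ z) s.mor)
          (≈-trans (∘-congˡ (E.agree z)) (≈-sym (through (E.h₁ z) t.mor)))
        where
        through : ∀ {L N} (h : Hom L N) (f : Hom M L) →
          h ∘ f ∘ M.leg (z l) ≈
          (h ∘ f ∘ A.inclusion z) ∘ Cocone.leg (proj₁ (A.subcolimit z)) (leaf l)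
        through h f = ≈-trans (∘-congʳ (∘-congʳ (≈-sym (A.leg-through z l))))
          (≈-sym (≈-trans assoc (∘-congʳ assoc)))

      agree-almost : ∀ q → (λ z → E.h₀ z ∘ s.mor ∘ M.leg q ≈ E.h₁ z ∘ t.mor ∘ M.leg q) ∈ Member G
      -- The cone has the constant family at `q` as its vertex: any `z` covering it takes the value
      -- `q`. The index `[]` is arbitrary.
      agree-almost q = proj₂ (proj₂ (proj₂ extension)) ((λ _ → q) , λ {z} z⊒q →
        let l , zl≡q = z⊒q [] in
        subst (λ q → E.h₀ z ∘ s.mor ∘ M.leg q ≈ E.h₁ z ∘ t.mor ∘ M.leg q) zl≡q (agree-on-leg z l))

      equivalent-in-limit : Equivalent K U s t
      equivalent-in-limit = limit-equivalent U U-preserves pM s t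
        (presentation s.target) (presentation t.target) E.h₀ E.h₁ agree-almost E.identify

  tame : IsTame K U
  tame = κ⁺ , κ⁺-regular , λ {M} s t ¬equivalent → dne λ none →
    ¬equivalent (equivalent-in-limit s t λ z →
      let open Approximation (presentation M) z in
      -- The absence of a distinguishing object yields an amalgam for every `z`.
      dne λ ¬e → none (X , X-presentable , inclusion , ¬e))

theorem5p2 : {o ℓ : Level} →
    ({a : Level} → ExcludedMiddle a) →
    AxiomOfChoice ℓ →
    ProperClassOfStronglyCompacts ℓ →
    (K : Category o ℓ) (U : Functor K (Sets ℓ)) →
    IsAccessibleWithConcreteDirectedColimits K U →
    AmalgamationProperty K →
    JointEmbeddingProperty K →
    IsTame K U
theorem5p2 {o} {ℓ} em ac strong K U concrete _ _ = tame
  where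
  open Category K using (Hom)
  open IsAccessibleWithConcreteDirectedColimits concrete

  μ : Set ℓ
  μ = proj₁ accessible

  μ-accessible : IsAccessibleFor μ K
  μ-accessible = proj₂ (proj₂ accessible)

  open IsAccessibleFor μ-accessible using (Index; generator)

  Arrows : Set ℓ
  Arrows = Σ[ a ∈ Index ] Σ[ b ∈ Index ] Hom (generator a) (generator b)

  -- A cardinal above this sum exceeds all three summands, and also each single hom-set, which
  -- embeds in `Arrows`.
  bound : Set ℓ
  bound = μ ⊎ (Index ⊎ Arrows)

  κ : Set ℓ
  κ = proj₁ (strong bound)

  ↣bound⇒≺κ : {B : Set ℓ} → B ↣ bound → B ≺ κ
  ↣bound⇒≺κ i = ↣-≺-trans i (proj₂ (proj₂ (strong bound)))

  μ≺κ : μ ≺ κ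
  μ≺κ = ↣bound⇒≺κ (mk↣ {to = inj₁} λ { refl → refl })

  Index≺κ : Index ≺ κ
  Index≺κ = ↣bound⇒≺κ (mk↣ {to = inj₂ ∘′ inj₁} λ { refl → refl })

  Hom≺κ : ∀ a b → Hom (generator a) (generator b) ≺ κ
  Hom≺κ a b = ↣bound⇒≺κ (mk↣ {to = λ u → inj₂ (inj₂ (a , b , u))} λ { refl → refl })

  open Tameness em ac K U (IsRegular.infinite (proj₁ (proj₂ accessible))) μ-accessible
    preservesDirected (proj₁ (proj₂ (strong bound))) (proj₁ μ≺κ) Index≺κ Hom≺κ
    using (tame)
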